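{- Let $a,b$ be coprime positive integers, let $\alpha_a,\alpha_b,\beta_a,\beta_b$ be constants, and let $f$ be a function satisfying $$f\left(\frac{ia}{b}\right)=\alpha_a\sum_{j=0}^{a-1}f\left(\frac{i}{b}+\frac{j}{a}\right)+\beta_a\quad (i=0,1,\dots,b-1),$$ $$f\left(\frac{jb}{a}\right)=\alpha_b\sum_{i=0}^{b-1}f\left(\frac{i}{b}+\frac{j}{a}\right)+\beta_b\quad (j=0,1,\dots,a-1).$$ Then $$\alpha_b\sum_{i=0}^{b-1}\frac{i}{b}f\left(\frac{ia}{b}\right)+\alpha_a\sum_{j=0}^{a-1}\frac{j}{a}f\left(\frac{jb}{a}\right)=\alpha_a\alpha_b\sum_{k\in C_{a,b}}\left(\left(\frac{k}{ab}+1\right)f\left(\frac{k}{ab}+1\right)-\frac{k}{ab}f\left(\frac{k}{ab}\right)\right)$$ $$+\alpha_a\alpha_b\sum_{k=0}^{ab-1}\frac{k}{ab}f\left(\frac{k}{ab}\right)+\frac{\alpha_b\beta_a(b-1)}{2}+\frac{\alpha_a\beta_b(a-1)}{2}.$$ In particular, for a $1$-periodic function $f$, $$\alpha_b\sum_{i=0}^{b-1}\frac{i}{b}f\left(\frac{ia}{b}\right)+\alpha_a\sum_{j=0}^{a-1}\frac{j}{a}f\left(\frac{jb}{a}\right)=\alpha_a\alpha_b\sum_{k\in C_{a,b}}f\left(\frac{k}{ab}\right)+\alpha_a\alpha_b\sum_{k=0}^{ab-1}\frac{k}{ab}f\left(\frac{k}{ab}\right)+\frac{\alpha_b\beta_a(b-1)}{2}+\frac{\alpha_a\beta_b(a-1)}{2},$$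 and for $f(x)=\bar B_n(x)$, $$ab^ns_n(a,b)+ba^ns_n(b,a)=\sum_{i=0}^n\binom{n}{i}(ab)^iB_i\,S_{a,b}(n-i)+\sum_{i=0}^{n+1}\frac{n!\,(ab)^{n-i+1}B_iB_{n-i+1}}{i!\,(n-i+1)!}+\frac{nB_{n+1}}{n+1}.$$
   Context: For coprime positive integers $a,b$, $S_{a,b}=\{ua+vb:\ u,v\in\mathbb{Z}_{\ge 0}\}$ is the numerical semigroup generated by $a,b$, and $C_{a,b}:=\mathbb{Z}_{\ge 0}\setminus S_{a,b}$ is its (finite) complement. The Sylvester sums are $S_{a,b}(m):=\sum_{k\in C_{a,b}}k^m$. The Bernoulli polynomials are $B_n(x)=\sum_{i=0}^n\binom{n}{i}B_ix^{n-i}$ with Bernoulli numbers $B_n=B_n(0)$, and the Bernoulli functions are $\bar B_n(x):=B_n(x-[x])$, where $[x]$ is the integer part of $x$. The Apostol–Dedekind sums are $s_n(a,b):=\sum_{k=1}^{b-1}\frac{k}{b}\bar B_n\left(\frac{ka}{b}\right)$.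
   Formalization: The last identity is false as printed for n=0, n=1 and all even n (for a=b=1, n=1: left side 0, right side 1/2); it is proved as printed for odd n≥3, and for every n≥0 with the extra summand ab·B_n on the right. -}

module Defs where

open import Level using (_⊔_) renaming (suc to lsuc)
open import Algebra.Bundles using (CommutativeRing)
open import Algebra.Bundles.Raw using (RawMonoid)
open import Algebra.Morphism.Structures using (module RingMorphisms)
import Algebra.Definitions.RawMonoid as RawMonoidDefs
import Algebra.Definitions.RawSemiring as RawSemiringDefs
open import Data.Fin.Base using (Fin; toℕ; fromℕ<)
open import Data.Fin.Properties using (any?; toℕ-fromℕ<)
open import Data.Integer.Base using (+_)
open import Data.List.Base using (List; []; _∷_; upTo; applyUpTo; filter)
open import Data.List.Membership.Propositional using (_∈_)
open import Data.List.Membership.Propositional.Properties using (∈-filter⁺; ∈-filter⁻; ∈-upTo⁺)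
open import Data.List.Relation.Unary.Unique.Propositional using (Unique)
import Data.List.Relation.Unary.Unique.Propositional.Properties as Unique
open import Data.Nat.Base as ℕ using (ℕ; zero; suc; NonZero; _≤_; s≤s)
open import Data.Nat.Combinatorics using (_C_)
open import Data.Nat.Coprimality using (Coprime; coprime-Bézout)
open import Data.Nat.Divisibility using (_∣_; divides; ∣m+n∣m⇒∣n; n∣m*n)
open import Data.Nat.DivMod using (_%_; m≡m%n+[m/n]*n; m%n<n)
open import Data.Nat.GCD using (module Bézout)
import Data.Nat.Properties as ℕ
open import Data.Nat.Tactic.RingSolver using (solve-∀)
open import Data.Product.Base using (_,_; ∃₂; proj₂)
open import Data.Rational.Base as ℚ using (ℚ; 1ℚ; _/_; floor)
open import Data.Vec.Base using (Vec; []; _∷ʳ_; lookup; last)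
open import Function.Base using (_∘_)
open import Function.Bundles using (_⇔_; mk⇔)
open import Relation.Binary.PropositionalEquality
  using (_≡_; refl; sym; trans; cong; cong₂; subst; module ≡-Reasoning)
open import Relation.Nullary.Decidable using (Dec; map′; ¬?)
open import Relation.Nullary.Negation using (¬_)

module FiniteSum {c ℓ} (M : RawMonoid c ℓ) where
  open RawMonoid M

  infix 5 ∑
  ∑ : List ℕ → (ℕ → Carrier) → Carrier
  ∑ []       f = ε
  ∑ (k ∷ ks) f = f k ∙ ∑ ks f

  syntax ∑ ks (λ k → e) = ∑[ k ∈ ks ] e

-- The unspecified range of f and home of the constants α, β: any commutative
-- ℚ-algebra, so in particular ℝ and ℂ.  Only rational arguments of f occur, so
-- f is taken on ℚ; functions on ℝ are covered by restriction.

record ℚAlgebra c ℓ : Set (lsuc (c ⊔ ℓ)) where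
  field
    commutativeRing : CommutativeRing c ℓ

  open CommutativeRing commutativeRing public

  field
    ι : ℚ → Carrier
    ι-isRingHomomorphism : RingMorphisms.IsRingHomomorphism ℚ.+-*-rawRing rawRing ι

  open FiniteSum +-rawMonoid public

------------------------------------------------------------------------
-- The numerical semigroup generated by a and b

InSemigroup : ℕ → ℕ → ℕ → Set
InSemigroup a b n = ∃₂ λ u v → u ℕ.* a ℕ.+ v ℕ.* b ≡ n

inSemigroup? : ∀ a b .{{_ : NonZero a}} .{{_ : NonZero b}} n → Dec (InSemigroup a b n)
inSemigroup? a b n = map′
  (λ (u , v , eq) → toℕ u , toℕ v , eq)
  (λ (u , v , eq) → let u≤n = subst (u ≤_) eq (ℕ.≤-trans (ℕ.m≤m*n u a) (ℕ.m≤m+n _ _))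
                        v≤n = subst (v ≤_) eq (ℕ.≤-trans (ℕ.m≤m*n v b) (ℕ.m≤n+m _ _))
    in fromℕ< (s≤s u≤n) , fromℕ< (s≤s v≤n) ,
       trans (cong₂ (λ x y → x ℕ.* a ℕ.+ y ℕ.* b) (toℕ-fromℕ< (s≤s u≤n)) (toℕ-fromℕ< (s≤s v≤n))) eq)
  (any? λ (u : Fin (suc n)) → any? λ (v : Fin (suc n)) →
     toℕ u ℕ.* a ℕ.+ toℕ v ℕ.* b ℕ.≟ n)

-- The complement C_{a,b}; the bound a b loses nothing, see ∈-gaps.

gaps : ∀ a b .{{_ : NonZero a}} .{{_ : NonZero b}} → List ℕ
gaps a b = filter (¬? ∘ inSemigroup? a b) (upTo (a ℕ.* b))

gaps-unique : ∀ a b .{{_ : NonZero a}} .{{_ : NonZero b}} → Unique (gaps a b)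
gaps-unique a b = Unique.filter⁺ (¬? ∘ inSemigroup? a b) (Unique.upTo⁺ (a ℕ.* b))

private
  semigroup-swap : ∀ {a b n} → InSemigroup b a n → InSemigroup a b n
  semigroup-swap (u , v , eq) = v , u , trans (ℕ.+-comm (v ℕ.* _) _) eq

  rearrange₁ : ∀ m k a b → (m ℕ.+ k ℕ.* b) ℕ.* a ≡ m ℕ.* a ℕ.+ k ℕ.* a ℕ.* b
  rearrange₁ = solve-∀

  rearrange₂ : ∀ n y b → n ℕ.* (1 ℕ.+ y ℕ.* b) ≡ n ℕ.* y ℕ.* b ℕ.+ n
  rearrange₂ = solve-∀

  rearrange₃ : ∀ p d m → p ℕ.+ (m ℕ.+ d) ≡ m ℕ.+ (p ℕ.+ d)
  rearrange₃ = solve-∀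

  bézout⇒large∈S : ∀ a b .{{_ : NonZero b}} x y → 1 ℕ.+ y ℕ.* b ≡ x ℕ.* a →
                   ∀ n → a ℕ.* b ≤ n → InSemigroup a b n
  bézout⇒large∈S a b x y eq n ab≤n = from-divides b∣d
    where
    open ≡-Reasoning
    u = (n ℕ.* x) % b
    q = (n ℕ.* x) ℕ./ b
    d = n ℕ.∸ u ℕ.* a

    ua≤n : u ℕ.* a ≤ n
    ua≤n = ℕ.≤-trans (ℕ.*-monoˡ-≤ a (ℕ.<⇒≤ (m%n<n (n ℕ.* x) b)))
             (subst (_≤ n) (ℕ.*-comm a b) ab≤n)

    ua+d≡n : u ℕ.* a ℕ.+ d ≡ n
    ua+d≡n = ℕ.m+[n∸m]≡n ua≤n

    nyb+d≡qab : n ℕ.* y ℕ.* b ℕ.+ d ≡ q ℕ.* a ℕ.* b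
    nyb+d≡qab = ℕ.+-cancelˡ-≡ (u ℕ.* a) _ _ (begin
      u ℕ.* a ℕ.+ (n ℕ.* y ℕ.* b ℕ.+ d) ≡⟨ rearrange₃ (n ℕ.* y ℕ.* b) d (u ℕ.* a) ⟨
      n ℕ.* y ℕ.* b ℕ.+ (u ℕ.* a ℕ.+ d) ≡⟨ cong (n ℕ.* y ℕ.* b ℕ.+_) ua+d≡n ⟩
      n ℕ.* y ℕ.* b ℕ.+ n               ≡⟨ rearrange₂ n y b ⟨
      n ℕ.* (1 ℕ.+ y ℕ.* b)             ≡⟨ cong (n ℕ.*_) eq ⟩
      n ℕ.* (x ℕ.* a)                   ≡⟨ ℕ.*-assoc n x a ⟨
      n ℕ.* x ℕ.* a                     ≡⟨ cong (ℕ._* a) (m≡m%n+[m/n]*n (n ℕ.* x) b) ⟩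
      (u ℕ.+ q ℕ.* b) ℕ.* a             ≡⟨ rearrange₁ u q a b ⟩
      u ℕ.* a ℕ.+ q ℕ.* a ℕ.* b         ∎)

    b∣d : b ∣ d
    b∣d = ∣m+n∣m⇒∣n (subst (b ∣_) (sym nyb+d≡qab) (n∣m*n (q ℕ.* a))) (n∣m*n (n ℕ.* y))

    from-divides : b ∣ d → InSemigroup a b n
    from-divides (divides v d≡vb) = u , v , trans (cong (u ℕ.* a ℕ.+_) (sym d≡vb)) ua+d≡n

large∈S : ∀ a b .{{_ : NonZero a}} .{{_ : NonZero b}} → Coprime a b →
          ∀ n → a ℕ.* b ≤ n → InSemigroup a b n
large∈S a b coprime n ab≤n with coprime-Bézout coprime
... | Bézout.Identity.+- x y eq = bézout⇒large∈S a b x y eq n ab≤n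
... | Bézout.Identity.-+ x y eq =
  semigroup-swap (bézout⇒large∈S b a y x eq n (subst (_≤ n) (ℕ.*-comm a b) ab≤n))

∈-gaps : ∀ a b .{{_ : NonZero a}} .{{_ : NonZero b}} → Coprime a b →
         ∀ k → k ∈ gaps a b ⇔ (¬ InSemigroup a b k)
∈-gaps a b coprime k = mk⇔
  (λ k∈ → proj₂ (∈-filter⁻ (¬? ∘ inSemigroup? a b) {xs = upTo (a ℕ.* b)} k∈))
  (λ k∉S → ∈-filter⁺ (¬? ∘ inSemigroup? a b)
     (∈-upTo⁺ (ℕ.≰⇒> (λ ab≤k → k∉S (large∈S a b coprime k ab≤k)))) k∉S)

sylvesterSum : ∀ a b .{{_ : NonZero a}} .{{_ : NonZero b}} → ℕ → ℕ
sylvesterSum a b m = ∑[ k ∈ gaps a b ] k ℕ.^ m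
  where open FiniteSum ℕ.+-0-rawMonoid

------------------------------------------------------------------------
-- Bernoulli numbers, polynomials and functions

open FiniteSum ℚ.+-0-rawMonoid
open RawSemiringDefs ℚ.+-*-rawSemiring using (_^_)

-- B₀ = 1 and  Σ_{i=0}^{n} (n+1 choose i) Bᵢ = 0  for n ≥ 1, that is
-- t/(eᵗ-1) = Σ Bₙ tⁿ/n!, so that B₁ = -1/2.  The vector holds B₀, …, Bₙ₋₁.

nextBernoulli : ∀ n → Vec ℚ n → ℚ
nextBernoulli zero      _  = 1ℚ
nextBernoulli n@(suc _) bs =
  ℚ.- ((+ 1 / suc n) ℚ.* sum λ (i : Fin n) → (+ (suc n C toℕ i) / 1) ℚ.* lookup bs i)
  where open RawMonoidDefs ℚ.+-0-rawMonoid using (sum)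

bernoullis : ∀ n → Vec ℚ n
bernoullis zero    = []
bernoullis (suc n) = bernoullis n ∷ʳ nextBernoulli n (bernoullis n)

bernoulli : ℕ → ℚ
bernoulli n = last (bernoullis (suc n))

bernoulliPoly : ℕ → ℚ → ℚ
bernoulliPoly n x =
  ∑[ i ∈ upTo (suc n) ] (+ (n C i) / 1) ℚ.* bernoulli i ℚ.* x ^ (n ℕ.∸ i)

bernoulliFun : ℕ → ℚ → ℚ
bernoulliFun n x = bernoulliPoly n (x ℚ.- (floor x / 1))

apostolDedekind : ℕ → (a b : ℕ) .{{_ : NonZero b}} → ℚ
apostolDedekind n a b =
  ∑[ k ∈ applyUpTo suc (b ℕ.∸ 1) ] (+ k / b) ℚ.* bernoulliFun n (+ (k ℕ.* a) / b)

{-# OPTIONS --safe #-}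

-- Inserting the functional equations turns the left-hand side into
-- αa αb Σ xᵢⱼ f(xᵢⱼ) plus the β-terms, where xᵢⱼ = (ia + jb)/(ab).  For i < b and
-- j < a the numbers ia + jb are distinct; those below ab are the elements of S
-- below ab, and the others are the k + ab with k in the complement C.
--
-- For Bernoulli functions the functional equations are Raabe's multiplication
-- formula, with αa = aⁿ⁻¹ and βa = 0.  What remains is Σ (k/N) Bₙ(k/N) for N = ab.
-- Let β(t) = t/(eᵗ - 1), so that (eᴺᵗ - 1)/(eᵗ - 1) = Σ eᵏᵗ gives
-- β(Nt) Σ eᵏᵗ = N β(t), and apply θ = t d/dt to this, with θβ = β - tβ - β².
-- Finally Bₙ = 0 for odd n > 1 because β(-t) = β(t) + t.

module Submission where

open import Defs
open import Level using (Level; 0ℓ)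
open import Algebra.Bundles using (CommutativeRing; CommutativeSemiring; CommutativeMonoid)
import Algebra.Definitions.RawMonoid as RawMonoidDefs
import Algebra.Definitions.RawSemiring as RawSemiringDefs
import Algebra.Morphism.Construct.Identity as Identity
open import Algebra.Morphism.Structures using (module RingMorphisms)
import Algebra.Properties.CommutativeSemigroup as CommutativeSemigroupProperties
import Algebra.Properties.CommutativeSemiring.Exp as Exp
import Algebra.Solver.Ring as RingSolver
open import Algebra.Solver.Ring.AlmostCommutativeRing
  using (fromCommutativeRing; _-Raw-AlmostCommutative⟶_)
open import Data.Fin.Base as Fin using (Fin)
import Data.Fin.Properties as Fin
import Data.Fin.Relation.Unary.Top as Top
open import Data.Integer.Base using (+_)
import Data.Integer.Base as ℤ
open import Data.Integer.DivMod using ([n/d]*d≤n; n<s[n/ℕd]*d; div-pos-is-/ℕ)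
import Data.Integer.Properties as ℤ
open import Data.List.Base using (List; []; _∷_; _++_; map; concat; filter; upTo; applyUpTo)
open import Data.List.Membership.Propositional using (_∈_)
open import Data.List.Membership.Propositional.Properties
  using (∈-upTo⁺; ∈-upTo⁻; ∈-applyUpTo⁺; ∈-applyUpTo⁻; ∈-concat⁺′; ∈-concat⁻′; ∈-filter⁺; ∈-filter⁻;
         ∈-++⁺ˡ; ∈-++⁺ʳ; ∈-++⁻; ∈-map⁺; ∈-map⁻)
open import Data.List.Membership.Propositional.Properties.WithK using (unique∧set⇒bag)
open import Data.List.Properties using (map-upTo; upTo-∷ʳ)
open import Data.List.Relation.Binary.BagAndSetEquality using (∼bag⇒↭)
open import Data.List.Relation.Binary.Permutation.Propositional as ↭ using (_↭_)
import Data.List.Relation.Unary.All.Properties as All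
import Data.List.Relation.Unary.AllPairs.Properties as AllPairs
open import Data.List.Relation.Unary.Any using (here; there)
open import Data.List.Relation.Unary.Unique.Propositional using (Unique)
import Data.List.Relation.Unary.Unique.Propositional.Properties as Unique
open import Data.Maybe.Base as Maybe using (Maybe)
open import Data.Nat.Base as ℕ using (ℕ; zero; suc; NonZero; _≤_; s≤s; _<_; _!)
open import Data.Nat.Combinatorics using (_C_; nCk≡nC[n∸k]; nC1≡n; nCn≡1; k![n∸k]!∣n!)
open import Data.Nat.Combinatorics.Specification using (nCk≡n!/k![n-k]!)
open import Data.Nat.Coprimality as Coprimality using (Coprime; coprime-divisor)
open import Data.Nat.DivMod using (_%_; m≡m%n+[m/n]*n; m%n<n; m/n*n≡m)
open import Data.Nat.Divisibility using (_∣_; ∣m+n∣m⇒∣n; n∣m*n; ∣⇒≤)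
open import Data.Nat.Properties using (m*n≢0; _!≢0; _!*_!≢0)
import Data.Nat.Properties as ℕ
open import Data.Nat.Tactic.RingSolver using (solve-∀)
open import Data.Product.Base using (_×_; _,_; ∃₂; proj₁)
open import Data.Rational.Base as ℚ using (ℚ; mkℚ; 1ℚ; _/_; floor)
import Data.Rational.Properties as ℚ
import Data.Rational.Solver as ℚ
open import Data.Rational.Unnormalised.Base as ℚᵘ using (mkℚᵘ; *≡*)
import Data.Rational.Unnormalised.Properties as ℚᵘ
open import Data.Sum.Base using (inj₁; inj₂)
open import Data.Vec.Base using (Vec; []; _∷_; _∷ʳ_; lookup)
open import Data.Vec.Properties using (last-∷ʳ)
open import Function.Base using (_∘_; id)
open import Function.Bundles using (Equivalence; mk⇔)
open import Relation.Binary.PropositionalEquality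
  using (_≡_; refl; sym; trans; cong; cong₂; subst; subst₂; module ≡-Reasoning)
import Relation.Binary.Reasoning.Setoid as ≈-Reasoning
open import Relation.Nullary.Decidable using (Dec; yes; no; ¬?; dec⇒maybe)
open import Relation.Nullary.Negation using (¬_; contradiction)

-- Fractions

-- The power series identities rest on two tools. The equation θf = x t f with f(0) = 1
-- characterises eˣᵗ, and eᵗ - 1, although not invertible, can be cancelled because it is t times a
-- series with constant term 1. Applying θ is what produces the weights, since θ eᵏᵗ = k t eᵏᵗ. The
-- formula for θβ then removes all derivatives: the product β(t) β(Nt) yields the double Bernoulli
-- sum with its powers of N, and -tβ - β² yields n Bₙ₊₁/(n + 1). A term N t β is left over, and it
-- contributes ab Bₙ. The displayed formula lacks it and holds exactly when Bₙ = 0. For a = b = 1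
-- and n = 0, for instance, the left side is 0 and the displayed right side is B₁ + B₁ = -1. Hence
-- the Bernoulli part of the theorem has two clauses: one for every n with ab Bₙ, and one without it
-- for odd n > 1.

/-toℚᵘ : ∀ i d .{{_ : NonZero d}} → ℚ.toℚᵘ (i / d) ℚᵘ.≃ i ℚᵘ./ d
/-toℚᵘ i (suc d) = ℚ.toℚᵘ-fromℚᵘ (mkℚᵘ i d)

/-cross : ∀ i j m n .{{_ : NonZero m}} .{{n≢0 : NonZero n}} →
          i ℤ.* + n ≡ j ℤ.* + m → i / m ≡ j / n
/-cross i j (suc m) (suc n) eq = ℚ.fromℚᵘ-cong {mkℚᵘ i m} {mkℚᵘ j n} (*≡* eq)

-- `_/_` divides out the gcd, so its arithmetic is transferred to unnormalised rationals, where sums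
-- and products are formed without cancellation and the two sides agree by computation.
/-+ : ∀ i j m n .{{_ : NonZero m}} .{{_ : NonZero n}} →
      (i / m) ℚ.+ (j / n) ≡ _/_ (i ℤ.* + n ℤ.+ j ℤ.* + m) (m ℕ.* n) {{m*n≢0 m n}}
/-+ i j (suc m) (suc n) = ℚ.toℚᵘ-injective (begin
  ℚ.toℚᵘ ((i / suc m) ℚ.+ (j / suc n))           ≈⟨ ℚ.toℚᵘ-homo-+ (i / suc m) (j / suc n) ⟩
  ℚ.toℚᵘ (i / suc m) ℚᵘ.+ ℚ.toℚᵘ (j / suc n)     ≈⟨ ℚᵘ.+-cong (/-toℚᵘ i (suc m)) (/-toℚᵘ j (suc n)) ⟩
  mkℚᵘ i m ℚᵘ.+ mkℚᵘ j n                         ≈⟨ ℚ.toℚᵘ-fromℚᵘ (mkℚᵘ i m ℚᵘ.+ mkℚᵘ j n) ⟨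
  ℚ.toℚᵘ ((i ℤ.* + suc n ℤ.+ j ℤ.* + suc m) / (suc m ℕ.* suc n)) ∎)
  where open ℚᵘ.≃-Reasoning

/-* : ∀ i j m n .{{_ : NonZero m}} .{{_ : NonZero n}} →
      (i / m) ℚ.* (j / n) ≡ _/_ (i ℤ.* j) (m ℕ.* n) {{m*n≢0 m n}}
/-* i j (suc m) (suc n) = ℚ.toℚᵘ-injective (begin
  ℚ.toℚᵘ ((i / suc m) ℚ.* (j / suc n))           ≈⟨ ℚ.toℚᵘ-homo-* (i / suc m) (j / suc n) ⟩
  ℚ.toℚᵘ (i / suc m) ℚᵘ.* ℚ.toℚᵘ (j / suc n)     ≈⟨ ℚᵘ.*-cong (/-toℚᵘ i (suc m)) (/-toℚᵘ j (suc n)) ⟩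
  mkℚᵘ i m ℚᵘ.* mkℚᵘ j n                         ≈⟨ ℚ.toℚᵘ-fromℚᵘ (mkℚᵘ i m ℚᵘ.* mkℚᵘ j n) ⟨
  ℚ.toℚᵘ ((i ℤ.* j) / (suc m ℕ.* suc n))         ∎)
  where open ℚᵘ.≃-Reasoning

fromℕ : ℕ → ℚ
fromℕ k = + k / 1

recip : (d : ℕ) .{{_ : NonZero d}} → ℚ
recip d = + 1 / d

-- Turns fractions into products, so that the ring solver can treat `recip d` as an atom and
-- `fromℕ-recip` is the only further fact about division.
/-split : ∀ k d .{{_ : NonZero d}} → + k / d ≡ fromℕ k ℚ.* recip d
/-split k d = begin
  + k / d                                     ≡⟨ /-cross (+ k) (+ k ℤ.* + 1) d (1 ℕ.* d) {{n≢0 = m*n≢0 1 d}} (cong₂ ℤ._*_ (sym (ℤ.*-identityʳ (+ k))) (cong +_ (ℕ.*-identityˡ d))) ⟩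
  _/_ (+ k ℤ.* + 1) (1 ℕ.* d) {{m*n≢0 1 d}}   ≡⟨ /-* (+ k) (+ 1) 1 d ⟨
  fromℕ k ℚ.* recip d                         ∎
  where open ≡-Reasoning

fromℕ-recip : ∀ d .{{_ : NonZero d}} → fromℕ d ℚ.* recip d ≡ 1ℚ
fromℕ-recip d = trans (sym (/-split d d)) (/-cross (+ d) (+ 1) d 1 (ℤ.*-comm (+ d) (+ 1)))

fromℕ-+ : ∀ m n → fromℕ (m ℕ.+ n) ≡ fromℕ m ℚ.+ fromℕ n
fromℕ-+ m n = trans
  (cong (_/ 1) (cong₂ ℤ._+_ (sym (ℤ.*-identityʳ (+ m))) (sym (ℤ.*-identityʳ (+ n)))))
  (sym (/-+ (+ m) (+ n) 1 1))

fromℕ-* : ∀ m n → fromℕ (m ℕ.* n) ≡ fromℕ m ℚ.* fromℕ n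
fromℕ-* m n = trans (cong (_/ 1) (ℤ.pos-* m n)) (sym (/-* (+ m) (+ n) 1 1))

fromℕ-cancel : ∀ d .{{_ : NonZero d}} {p q} → fromℕ d ℚ.* p ≡ fromℕ d ℚ.* q → p ≡ q
fromℕ-cancel d {p} {q} eq = begin
  p                                 ≡⟨ expand p ⟩
  recip d ℚ.* (fromℕ d ℚ.* p)       ≡⟨ cong (recip d ℚ.*_) eq ⟩
  recip d ℚ.* (fromℕ d ℚ.* q)       ≡⟨ expand q ⟨
  q                                 ∎
  where
  open ≡-Reasoning
  expand : ∀ r → r ≡ recip d ℚ.* (fromℕ d ℚ.* r)
  expand r = begin
    r                               ≡⟨ ℚ.*-identityˡ r ⟨
    1ℚ ℚ.* r                        ≡⟨ cong (ℚ._* r) (fromℕ-recip d) ⟨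
    fromℕ d ℚ.* recip d ℚ.* r       ≡⟨ cong (ℚ._* r) (ℚ.*-comm (fromℕ d) (recip d)) ⟩
    recip d ℚ.* fromℕ d ℚ.* r       ≡⟨ ℚ.*-assoc (recip d) (fromℕ d) r ⟩
    recip d ℚ.* (fromℕ d ℚ.* r)     ∎

fromℕ-*-/ : ∀ k d .{{_ : NonZero d}} → fromℕ d ℚ.* (+ k / d) ≡ fromℕ k
fromℕ-*-/ k d = begin
  fromℕ d ℚ.* (+ k / d)                ≡⟨ cong (fromℕ d ℚ.*_) (/-split k d) ⟩
  fromℕ d ℚ.* (fromℕ k ℚ.* recip d)    ≡⟨ solve 3 (λ d k r → d :* (k :* r) := (d :* r) :* k) refl (fromℕ d) (fromℕ k) (recip d) ⟩
  fromℕ d ℚ.* recip d ℚ.* fromℕ k      ≡⟨ cong (ℚ._* fromℕ k) (fromℕ-recip d) ⟩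
  1ℚ ℚ.* fromℕ k                       ≡⟨ ℚ.*-identityˡ (fromℕ k) ⟩
  fromℕ k                              ∎
  where
  open ≡-Reasoning
  open ℚ.+-*-Solver

recip-* : ∀ m n .{{_ : NonZero m}} .{{_ : NonZero n}} →
          recip m ℚ.* recip n ≡ recip (m ℕ.* n) {{m*n≢0 m n}}
recip-* m n = /-* (+ 1) (+ 1) m n

/-+-ℕ : ∀ i j m n .{{_ : NonZero m}} .{{_ : NonZero n}} →
        (+ i / m) ℚ.+ (+ j / n) ≡ _/_ (+ (i ℕ.* n ℕ.+ j ℕ.* m)) (m ℕ.* n) {{m*n≢0 m n}}
/-+-ℕ i j m n = trans (/-+ (+ i) (+ j) m n)
  (cong (λ z → _/_ z (m ℕ.* n) {{m*n≢0 m n}})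
    (cong₂ ℤ._+_ (sym (ℤ.pos-* i n)) (sym (ℤ.pos-* j m))))

-- Coefficients are rationals embedded by `ι`: their equality is decidable, whereas that of an
-- arbitrary carrier is not.
module ℚAlgebraSolver {c ℓ} (K : ℚAlgebra c ℓ) where
  open ℚAlgebra K
  private
    module ι = RingMorphisms.IsRingHomomorphism ι-isRingHomomorphism

    morphism : ℚ.+-*-rawRing -Raw-AlmostCommutative⟶ fromCommutativeRing commutativeRing
    morphism = record
      { ⟦_⟧    = ι
      ; +-homo = ι.+-homo
      ; *-homo = ι.*-homo
      ; -‿homo = ι.-‿homo
      ; 0-homo = ι.0#-homo
      ; 1-homo = ι.1#-homo
      }

    _coeff≟_ : ∀ p q → Maybe (ι p ≈ ι q)
    p coeff≟ q = Maybe.map (λ p≡q → reflexive (cong ι p≡q)) (dec⇒maybe (p ℚ.≟ q))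

  open RingSolver ℚ.+-*-rawRing (fromCommutativeRing commutativeRing) morphism _coeff≟_ public

-- Finite sums

module Sums {c ℓ} (R : CommutativeSemiring c ℓ) where
  open CommutativeSemiring R
    renaming (refl to ≈-refl; sym to ≈-sym; trans to ≈-trans)
  open FiniteSum +-rawMonoid
  open ≈-Reasoning setoid
  open CommutativeSemigroupProperties
    (CommutativeMonoid.commutativeSemigroup +-commutativeMonoid) using (interchange; x∙yz≈y∙xz)

  ∑-cong-∈ : ∀ ks {f g : ℕ → Carrier} → (∀ {k} → k ∈ ks → f k ≈ g k) → ∑ ks f ≈ ∑ ks g
  ∑-cong-∈ []       f≈g = ≈-refl
  ∑-cong-∈ (k ∷ ks) f≈g = +-cong (f≈g (here refl)) (∑-cong-∈ ks (λ k∈ → f≈g (there k∈)))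

  ∑-cong : ∀ ks {f g : ℕ → Carrier} → (∀ k → f k ≈ g k) → ∑ ks f ≈ ∑ ks g
  ∑-cong ks f≈g = ∑-cong-∈ ks (λ {k} _ → f≈g k)

  ∑-cong-< : ∀ n {f g : ℕ → Carrier} → (∀ k → k < n → f k ≈ g k) → ∑ (upTo n) f ≈ ∑ (upTo n) g
  ∑-cong-< n f≈g = ∑-cong-∈ (upTo n) (λ k∈ → f≈g _ (∈-upTo⁻ k∈))

  ∑-+ : ∀ ks (f g : ℕ → Carrier) → ∑[ k ∈ ks ] (f k + g k) ≈ ∑ ks f + ∑ ks g
  ∑-+ []       f g = ≈-sym (+-identityˡ 0#)
  ∑-+ (k ∷ ks) f g = ≈-trans (+-congˡ (∑-+ ks f g)) (interchange (f k) (g k) (∑ ks f) (∑ ks g))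

  ∑-0 : ∀ ks → ∑[ k ∈ ks ] 0# ≈ 0#
  ∑-0 []       = ≈-refl
  ∑-0 (k ∷ ks) = ≈-trans (+-identityˡ _) (∑-0 ks)

  *-∑ : ∀ x ks (f : ℕ → Carrier) → x * ∑ ks f ≈ ∑[ k ∈ ks ] x * f k
  *-∑ x []       f = zeroʳ x
  *-∑ x (k ∷ ks) f = ≈-trans (distribˡ x _ _) (+-congˡ (*-∑ x ks f))

  ∑-* : ∀ x ks (f : ℕ → Carrier) → ∑ ks f * x ≈ ∑[ k ∈ ks ] f k * x
  ∑-* x ks f = ≈-trans (*-comm _ x) (≈-trans (*-∑ x ks f) (∑-cong ks (λ k → *-comm x (f k))))

  ∑-swap : ∀ ks ls (f : ℕ → ℕ → Carrier) →
           ∑[ k ∈ ks ] (∑[ l ∈ ls ] f k l) ≈ ∑[ l ∈ ls ] (∑[ k ∈ ks ] f k l)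
  ∑-swap []       ls f = ≈-sym (∑-0 ls)
  ∑-swap (k ∷ ks) ls f = ≈-trans (+-congˡ (∑-swap ks ls f))
    (≈-sym (∑-+ ls (f k) (λ l → ∑[ k ∈ ks ] f k l)))

  ∑-map : ∀ (h : ℕ → ℕ) ks (f : ℕ → Carrier) → ∑ (map h ks) f ≡ ∑[ k ∈ ks ] f (h k)
  ∑-map h []       f = refl
  ∑-map h (k ∷ ks) f = cong (λ s → f (h k) + s) (∑-map h ks f)

  ∑-applyUpTo : ∀ (h : ℕ → ℕ) n (f : ℕ → Carrier) → ∑ (applyUpTo h n) f ≡ ∑[ k ∈ upTo n ] f (h k)
  ∑-applyUpTo h n f = trans (cong (λ ks → ∑ ks f) (sym (map-upTo h n))) (∑-map h (upTo n) f)

  ∑-upTo-suc : ∀ n (f : ℕ → Carrier) → ∑ (upTo (suc n)) f ≡ f 0 + (∑[ k ∈ upTo n ] f (suc k))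
  ∑-upTo-suc n f = cong (λ s → f 0 + s) (∑-applyUpTo suc n f)

  ∑-++ : ∀ ks ls (f : ℕ → Carrier) → ∑ (ks ++ ls) f ≈ ∑ ks f + ∑ ls f
  ∑-++ []       ls f = ≈-sym (+-identityˡ _)
  ∑-++ (k ∷ ks) ls f = ≈-trans (+-congˡ (∑-++ ks ls f)) (≈-sym (+-assoc _ _ _))

  ∑-upTo-∷ʳ : ∀ n (f : ℕ → Carrier) → ∑ (upTo (suc n)) f ≈ ∑ (upTo n) f + f n
  ∑-upTo-∷ʳ n f = begin
    ∑ (upTo (suc n)) f        ≡⟨ cong (λ ks → ∑ ks f) (upTo-∷ʳ n) ⟨
    ∑ (upTo n ++ n ∷ []) f    ≈⟨ ∑-++ (upTo n) (n ∷ []) f ⟩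
    ∑ (upTo n) f + (f n + 0#) ≈⟨ +-congˡ (+-identityʳ (f n)) ⟩
    ∑ (upTo n) f + f n        ∎

  ∑-concat : ∀ (h : ℕ → List ℕ) n (f : ℕ → Carrier) →
             ∑ (concat (applyUpTo h n)) f ≈ ∑[ k ∈ upTo n ] (∑ (h k) f)
  ∑-concat h zero    f = ≈-refl
  ∑-concat h (suc n) f = begin
    ∑ (h 0 ++ concat (applyUpTo (λ k → h (suc k)) n)) f     ≈⟨ ∑-++ (h 0) _ f ⟩
    ∑ (h 0) f + ∑ (concat (applyUpTo (λ k → h (suc k)) n)) f ≈⟨ +-congˡ (∑-concat (λ k → h (suc k)) n f) ⟩
    ∑ (h 0) f + (∑[ k ∈ upTo n ] (∑ (h (suc k)) f))             ≡⟨ ∑-upTo-suc n (λ k → ∑ (h k) f) ⟨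
    ∑[ k ∈ upTo (suc n) ] (∑ (h k) f)                         ∎

  ∑-↭ : ∀ {ks ls} (f : ℕ → Carrier) → ks ↭ ls → ∑ ks f ≈ ∑ ls f
  ∑-↭ f ↭.refl                   = ≈-refl
  ∑-↭ f (↭.prep k ks↭ls)         = +-congˡ (∑-↭ f ks↭ls)
  ∑-↭ f (↭.swap k l ks↭ls)       = ≈-trans (x∙yz≈y∙xz _ _ _) (+-congˡ (+-congˡ (∑-↭ f ks↭ls)))
  ∑-↭ f (↭.trans ks↭ls ls↭ms)    = ≈-trans (∑-↭ f ks↭ls) (∑-↭ f ls↭ms)

  ∑-filter : ∀ {p} {P : ℕ → Set p} (P? : ∀ k → Dec (P k)) ks (f : ℕ → Carrier) →
             ∑ (filter P? ks) f + ∑ (filter (¬? ∘ P?) ks) f ≈ ∑ ks f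
  ∑-filter P? []       f = +-identityˡ 0#
  ∑-filter P? (k ∷ ks) f with P? k
  ... | yes _ = ≈-trans (+-assoc _ _ _) (+-congˡ (∑-filter P? ks f))
  ... | no  _ = ≈-trans (x∙yz≈y∙xz _ _ _) (+-congˡ (∑-filter P? ks f))

  -- Moving the window by one step drops `f 0` and gains `f n`, which are equal by periodicity.
  ∑-shift : ∀ n m {f : ℕ → Carrier} → (∀ k → f (k ℕ.+ n) ≈ f k) →
            ∑[ k ∈ upTo n ] f (m ℕ.+ k) ≈ ∑ (upTo n) f
  ∑-shift n zero            f-periodic = ≈-refl
  ∑-shift n (suc m) {f}     f-periodic = begin
    -- The induction hypothesis is applied to the shifted function, which has the same period.
    ∑[ k ∈ upTo n ] f (suc (m ℕ.+ k)) ≈⟨ ∑-shift n m (λ k → f-periodic (suc k)) ⟩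
    (∑[ k ∈ upTo n ] f (suc k))         ≈⟨ rotate n f-periodic ⟩
    ∑ (upTo n) f                      ∎
    where
    rotate : ∀ n → (∀ k → f (k ℕ.+ n) ≈ f k) → (∑[ k ∈ upTo n ] f (suc k)) ≈ ∑ (upTo n) f
    rotate zero    _     = ≈-refl
    rotate (suc n) f-per = begin
      (∑[ k ∈ upTo (suc n) ] f (suc k))       ≈⟨ ∑-upTo-∷ʳ n (λ k → f (suc k)) ⟩
      (∑[ k ∈ upTo n ] f (suc k)) + f (suc n) ≈⟨ +-congˡ (f-per 0) ⟩
      (∑[ k ∈ upTo n ] f (suc k)) + f 0       ≈⟨ +-comm _ (f 0) ⟩
      f 0 + (∑[ k ∈ upTo n ] f (suc k))       ≡⟨ ∑-upTo-suc n f ⟨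
      ∑ (upTo (suc n)) f                    ∎

-- Representations i a + j b

module _ (a b : ℕ) where

  combinationsRow : ℕ → List ℕ
  combinationsRow i = applyUpTo (λ j → i ℕ.* a ℕ.+ j ℕ.* b) a

  -- A single list, so that the rearrangement of the double sum can be expressed as a permutation.
  combinations : List ℕ
  combinations = concat (applyUpTo combinationsRow b)

  ∈-combinations⁺ : ∀ {i j} → i < b → j < a → i ℕ.* a ℕ.+ j ℕ.* b ∈ combinations
  ∈-combinations⁺ i<b j<a = ∈-concat⁺′ (∈-applyUpTo⁺ _ j<a) (∈-applyUpTo⁺ combinationsRow i<b)

  ∈-combinations⁻ : ∀ {k} → k ∈ combinations →
                    ∃₂ λ i j → i < b × j < a × k ≡ i ℕ.* a ℕ.+ j ℕ.* b
  ∈-combinations⁻ k∈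
    with _ , k∈row , row∈ ← ∈-concat⁻′ (applyUpTo combinationsRow b) k∈
    with i , i<b , refl ← ∈-applyUpTo⁻ combinationsRow row∈
    with j , j<a , eq ← ∈-applyUpTo⁻ _ k∈row
    = i , j , i<b , j<a , eq

-- If i ≤ u the difference of the two representations gives b ∣ u ∸ i.
representation-unique-≤ : ∀ {a b} .{{_ : NonZero b}} → Coprime a b → ∀ {i u} j v → i ≤ u → u < b →
  i ℕ.* a ℕ.+ j ℕ.* b ≡ u ℕ.* a ℕ.+ v ℕ.* b → i ≡ u
representation-unique-≤ {a} {b} coprime {i} {u} j v i≤u u<b eq = begin
  i               ≡⟨ ℕ.+-identityʳ i ⟨
  i ℕ.+ 0         ≡⟨ cong (i ℕ.+_) d≡0 ⟨
  i ℕ.+ (u ℕ.∸ i) ≡⟨ ℕ.m+[n∸m]≡n i≤u ⟩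
  u               ∎
  where
  open ≡-Reasoning
  d = u ℕ.∸ i

  jb≡da+vb : j ℕ.* b ≡ d ℕ.* a ℕ.+ v ℕ.* b
  jb≡da+vb = ℕ.+-cancelˡ-≡ (i ℕ.* a) _ _ (begin
    i ℕ.* a ℕ.+ j ℕ.* b                     ≡⟨ eq ⟩
    u ℕ.* a ℕ.+ v ℕ.* b                     ≡⟨ cong (λ w → w ℕ.* a ℕ.+ v ℕ.* b) (ℕ.m+[n∸m]≡n i≤u) ⟨
    (i ℕ.+ d) ℕ.* a ℕ.+ v ℕ.* b             ≡⟨ cong (ℕ._+ v ℕ.* b) (ℕ.*-distribʳ-+ a i d) ⟩
    i ℕ.* a ℕ.+ d ℕ.* a ℕ.+ v ℕ.* b         ≡⟨ ℕ.+-assoc (i ℕ.* a) _ _ ⟩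
    i ℕ.* a ℕ.+ (d ℕ.* a ℕ.+ v ℕ.* b)       ∎)

  b∣ad : b ∣ a ℕ.* d
  b∣ad = subst (b ∣_) (ℕ.*-comm d a)
    (∣m+n∣m⇒∣n (subst (b ∣_) (trans jb≡da+vb (ℕ.+-comm _ (v ℕ.* b))) (n∣m*n j)) (n∣m*n v))

  d≡0 : d ≡ 0
  d≡0 with d in d≡ | coprime-divisor (Coprimality.sym coprime) b∣ad
  ... | zero  | _   = refl
  ... | suc e | b∣d = contradiction (∣⇒≤ b∣d)
    (ℕ.<⇒≱ (subst (_< b) d≡ (ℕ.≤-<-trans (ℕ.m∸n≤m u i) u<b)))

representation-unique : ∀ {a b} .{{_ : NonZero b}} → Coprime a b → ∀ {i u} j v → i < b → u < b →
  i ℕ.* a ℕ.+ j ℕ.* b ≡ u ℕ.* a ℕ.+ v ℕ.* b → i ≡ u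
representation-unique coprime {i} {u} j v i<b u<b eq with ℕ.≤-total i u
... | inj₁ i≤u = representation-unique-≤ coprime j v i≤u u<b eq
... | inj₂ u≤i = sym (representation-unique-≤ coprime v j u≤i i<b (sym eq))

-- Within a row, i a and the factor b cancel; between rows, the value already determines i.
combinations-unique : ∀ a b .{{_ : NonZero b}} → Coprime a b → Unique (combinations a b)
combinations-unique a b coprime = Unique.concat⁺
  (All.applyUpTo⁺₂ (combinationsRow a b) b (λ i → Unique.applyUpTo⁺₁ _ a (λ {j} {j′} j<j′ _ eq →
     ℕ.<⇒≢ j<j′ (ℕ.*-cancelʳ-≡ j j′ b (ℕ.+-cancelˡ-≡ (i ℕ.* a) _ _ eq)))))
  (AllPairs.applyUpTo⁺₁ (combinationsRow a b) b (λ i<i′ i′<b (k∈row , k∈row′) →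
     let j  , _ , eq  = ∈-applyUpTo⁻ _ k∈row
         j′ , _ , eq′ = ∈-applyUpTo⁻ _ k∈row′
     in ℕ.<⇒≢ i<i′ (representation-unique coprime j j′ (ℕ.<-trans i<i′ i′<b) i′<b (trans (sym eq) eq′))))

-- Semigroup elements below ab and shifted gaps

module _ (a b : ℕ) .{{_ : NonZero a}} .{{_ : NonZero b}} (coprime : Coprime a b) where

  private
    semigroupPart = filter (inSemigroup? a b) (upTo (a ℕ.* b))
    shiftedGaps   = map (ℕ._+ a ℕ.* b) (gaps a b)

    -- The point is that k - ab is a gap when k = i a + j b ≥ ab. Given k - ab = u a + v b, reduce u
    -- modulo b and move the removed multiples of ab into v. Then k = u′ a + (v′ + a) b with u′ < b,
    -- and uniqueness of the representation forces j = v′ + a ≥ a, against j < a.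
    ∈⇒ : ∀ {k} → k ∈ combinations a b → k ∈ semigroupPart ++ shiftedGaps
    ∈⇒ k∈ with i , j , i<b , j<a , refl ← ∈-combinations⁻ a b k∈
      with i ℕ.* a ℕ.+ j ℕ.* b ℕ.<? a ℕ.* b
    ... | yes k<ab = ∈-++⁺ˡ (∈-filter⁺ (inSemigroup? a b) (∈-upTo⁺ k<ab) (i , j , refl))
    ... | no  k≮ab = ∈-++⁺ʳ semigroupPart
      (subst (_∈ shiftedGaps) (ℕ.m∸n+n≡m ab≤k)
        (∈-map⁺ (ℕ._+ a ℕ.* b) (Equivalence.from (∈-gaps a b coprime k-ab) k-ab∉S)))
      where
      open ≡-Reasoning
      ab≤k = ℕ.≮⇒≥ k≮ab
      k-ab = i ℕ.* a ℕ.+ j ℕ.* b ℕ.∸ a ℕ.* b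

      k-ab∉S : ¬ InSemigroup a b k-ab
      k-ab∉S (u , v , eq) = ℕ.<⇒≱ j<a (subst (a ≤_) (sym j≡) (ℕ.m≤n+m a v′))
        where
        u′ = u % b
        v′ = u ℕ./ b ℕ.* a ℕ.+ v

        eq′ : i ℕ.* a ℕ.+ j ℕ.* b ≡ u′ ℕ.* a ℕ.+ (v′ ℕ.+ a) ℕ.* b
        eq′ = begin
          i ℕ.* a ℕ.+ j ℕ.* b                             ≡⟨ ℕ.m∸n+n≡m ab≤k ⟨
          k-ab ℕ.+ a ℕ.* b                                ≡⟨ cong (ℕ._+ a ℕ.* b) eq ⟨
          u ℕ.* a ℕ.+ v ℕ.* b ℕ.+ a ℕ.* b                 ≡⟨ cong (λ w → w ℕ.* a ℕ.+ v ℕ.* b ℕ.+ a ℕ.* b) (m≡m%n+[m/n]*n u b) ⟩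
          (u′ ℕ.+ u ℕ./ b ℕ.* b) ℕ.* a ℕ.+ v ℕ.* b ℕ.+ a ℕ.* b ≡⟨ rearrange u′ (u ℕ./ b) v a b ⟩
          u′ ℕ.* a ℕ.+ (v′ ℕ.+ a) ℕ.* b                   ∎
          where
          rearrange : ∀ u′ q v a b → (u′ ℕ.+ q ℕ.* b) ℕ.* a ℕ.+ v ℕ.* b ℕ.+ a ℕ.* b
                                     ≡ u′ ℕ.* a ℕ.+ (q ℕ.* a ℕ.+ v ℕ.+ a) ℕ.* b
          rearrange = solve-∀

        i≡u′ : i ≡ u′
        i≡u′ = representation-unique coprime j (v′ ℕ.+ a) i<b (m%n<n u b) eq′

        j≡ : j ≡ v′ ℕ.+ a
        j≡ = ℕ.*-cancelʳ-≡ j _ b (ℕ.+-cancelˡ-≡ (i ℕ.* a) _ _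
          (trans eq′ (cong (λ w → w ℕ.* a ℕ.+ (v′ ℕ.+ a) ℕ.* b) (sym i≡u′))))

    -- For an element of S below ab both coefficients are in range by size alone. For a gap g, the
    -- number g + ab lies in S by `large∈S`. If its coefficients had u ≥ b or v ≥ a, then ab could
    -- be subtracted from that representation and g would lie in S.
    ∈⇐ : ∀ {k} → k ∈ semigroupPart ++ shiftedGaps → k ∈ combinations a b
    ∈⇐ k∈ with ∈-++⁻ semigroupPart k∈
    ∈⇐ k∈ | inj₁ k∈S with k∈upTo , u , v , refl ← ∈-filter⁻ (inSemigroup? a b) {xs = upTo (a ℕ.* b)} k∈S
      = ∈-combinations⁺ a b
          (ℕ.*-cancelʳ-< a u b (subst (u ℕ.* a <_) (ℕ.*-comm a b)
            (ℕ.≤-<-trans (ℕ.m≤m+n (u ℕ.* a) _) (∈-upTo⁻ k∈upTo))))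
          (ℕ.*-cancelʳ-< b v a (ℕ.≤-<-trans (ℕ.m≤n+m (v ℕ.* b) (u ℕ.* a)) (∈-upTo⁻ k∈upTo)))
    ∈⇐ k∈ | inj₂ k∈gaps with g , g∈ , refl ← ∈-map⁻ _ k∈gaps
      with u , v , eq ← large∈S a b coprime (g ℕ.+ a ℕ.* b) (ℕ.m≤n+m (a ℕ.* b) g)
      = subst (_∈ combinations a b) eq (∈-combinations⁺ a b u<b v<a)
      where
      open ≡-Reasoning
      g∉S = Equivalence.to (∈-gaps a b coprime g) g∈

      u<b : u < b
      u<b = ℕ.≰⇒> λ b≤u → g∉S (u ℕ.∸ b , v , ℕ.+-cancelʳ-≡ (a ℕ.* b) _ _ (begin
        (u ℕ.∸ b) ℕ.* a ℕ.+ v ℕ.* b ℕ.+ a ℕ.* b ≡⟨ rearrange (u ℕ.∸ b) v a b ⟩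
        (u ℕ.∸ b ℕ.+ b) ℕ.* a ℕ.+ v ℕ.* b       ≡⟨ cong (λ w → w ℕ.* a ℕ.+ v ℕ.* b) (ℕ.m∸n+n≡m b≤u) ⟩
        u ℕ.* a ℕ.+ v ℕ.* b                     ≡⟨ eq ⟩
        g ℕ.+ a ℕ.* b                           ∎))
        where
        rearrange : ∀ d v a b → d ℕ.* a ℕ.+ v ℕ.* b ℕ.+ a ℕ.* b ≡ (d ℕ.+ b) ℕ.* a ℕ.+ v ℕ.* b
        rearrange = solve-∀

      v<a : v < a
      v<a = ℕ.≰⇒> λ a≤v → g∉S (u , v ℕ.∸ a , ℕ.+-cancelʳ-≡ (a ℕ.* b) _ _ (begin
        u ℕ.* a ℕ.+ (v ℕ.∸ a) ℕ.* b ℕ.+ a ℕ.* b ≡⟨ rearrange u (v ℕ.∸ a) a b ⟩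
        u ℕ.* a ℕ.+ (v ℕ.∸ a ℕ.+ a) ℕ.* b       ≡⟨ cong (λ w → u ℕ.* a ℕ.+ w ℕ.* b) (ℕ.m∸n+n≡m a≤v) ⟩
        u ℕ.* a ℕ.+ v ℕ.* b                     ≡⟨ eq ⟩
        g ℕ.+ a ℕ.* b                           ∎))
        where
        rearrange : ∀ u d a b → u ℕ.* a ℕ.+ d ℕ.* b ℕ.+ a ℕ.* b ≡ u ℕ.* a ℕ.+ (d ℕ.+ a) ℕ.* b
        rearrange = solve-∀

    unique : Unique (semigroupPart ++ shiftedGaps)
    unique = Unique.++⁺
      (Unique.filter⁺ (inSemigroup? a b) (Unique.upTo⁺ (a ℕ.* b)))
      (Unique.map⁺ (ℕ.+-cancelʳ-≡ (a ℕ.* b) _ _) (gaps-unique a b))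
      (λ (k∈S , k∈gaps) →
        let g , _ , k≡ = ∈-map⁻ _ k∈gaps
            k<ab       = ∈-upTo⁻ (proj₁ (∈-filter⁻ (inSemigroup? a b) {xs = upTo (a ℕ.* b)} k∈S))
        in ℕ.<⇒≱ k<ab (subst (a ℕ.* b ≤_) (sym k≡) (ℕ.m≤n+m (a ℕ.* b) g)))

  -- Two lists without repetitions and with the same members are permutations of each other.
  combinations-↭ : combinations a b ↭ semigroupPart ++ shiftedGaps
  combinations-↭ = ∼bag⇒↭ (unique∧set⇒bag (combinations-unique a b coprime) unique (mk⇔ ∈⇒ ∈⇐))

  module _ {c ℓ} (R : CommutativeSemiring c ℓ) where
    open CommutativeSemiring R using (Carrier; _≈_; _+_; setoid; +-cong; +-congˡ; +-congʳ; reflexive; +-rawMonoid; +-assoc; +-comm)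
    open FiniteSum +-rawMonoid
    open Sums R
    open ≈-Reasoning setoid

    -- Semigroup elements and gaps together fill the range below ab. The sum over the gaps is added
    -- on the left, which keeps the identity free of subtraction.
    ∑-combinations : ∀ (G : ℕ → Carrier) →
      (∑[ i ∈ upTo b ] (∑[ j ∈ upTo a ] G (i ℕ.* a ℕ.+ j ℕ.* b))) + ∑ (gaps a b) G
      ≈ (∑[ k ∈ gaps a b ] G (k ℕ.+ a ℕ.* b)) + ∑ (upTo (a ℕ.* b)) G
    ∑-combinations G = begin
      (∑[ i ∈ upTo b ] (∑[ j ∈ upTo a ] G (i ℕ.* a ℕ.+ j ℕ.* b))) + ∑ (gaps a b) G
        ≈⟨ +-congʳ (∑-cong (upTo b) (λ i → reflexive (∑-applyUpTo (λ j → i ℕ.* a ℕ.+ j ℕ.* b) a G))) ⟨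
      (∑[ i ∈ upTo b ] (∑ (applyUpTo (λ j → i ℕ.* a ℕ.+ j ℕ.* b) a) G)) + ∑ (gaps a b) G
        ≈⟨ +-congʳ (∑-concat (combinationsRow a b) b G) ⟨
      ∑ (combinations a b) G + ∑ (gaps a b) G
        ≈⟨ +-congʳ (∑-↭ G combinations-↭) ⟩
      ∑ (semigroupPart ++ shiftedGaps) G + ∑ (gaps a b) G
        ≈⟨ +-congʳ (∑-++ semigroupPart shiftedGaps G) ⟩
      ∑ semigroupPart G + ∑ shiftedGaps G + ∑ (gaps a b) G
        ≈⟨ +-congʳ (+-comm _ _) ⟩
      ∑ shiftedGaps G + ∑ semigroupPart G + ∑ (gaps a b) G
        ≈⟨ +-assoc _ _ _ ⟩
      ∑ shiftedGaps G + (∑ semigroupPart G + ∑ (gaps a b) G)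
        ≈⟨ +-cong (reflexive (∑-map (ℕ._+ a ℕ.* b) (gaps a b) G)) (∑-filter (inSemigroup? a b) (upTo (a ℕ.* b)) G) ⟩
      (∑[ k ∈ gaps a b ] G (k ℕ.+ a ℕ.* b)) + ∑ (upTo (a ℕ.* b)) G ∎

-- The reciprocity law

ℚ-ℚAlgebra : ℚAlgebra 0ℓ 0ℓ
ℚ-ℚAlgebra = record
  { commutativeRing       = ℚ.+-*-commutativeRing
  ; ι                     = id
  ; ι-isRingHomomorphism  = Identity.isRingHomomorphism ℚ.+-*-rawRing refl
  }

module ℚSums = Sums (CommutativeRing.commutativeSemiring ℚ.+-*-commutativeRing)

fromℕ-suc : ∀ n → fromℕ (suc n) ≡ 1ℚ ℚ.+ fromℕ n
fromℕ-suc = fromℕ-+ 1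

-- The source of the factors (b - 1)/2 and (a - 1)/2: the total of the weights that multiply a
-- constant β.
∑-fractions : ∀ b .{{_ : NonZero b}} →
              FiniteSum.∑ ℚ.+-0-rawMonoid (upTo b) (λ i → + i / b) ≡ + (b ℕ.∸ 1) / 2
∑-fractions b@(suc m) = begin
  (∑[ i ∈ upTo b ] (+ i / b))                ≡⟨ ∑-cong (upTo b) (λ i → /-split i b) ⟩
  (∑[ i ∈ upTo b ] fromℕ i ℚ.* recip b)      ≡⟨ ∑-* (recip b) (upTo b) fromℕ ⟨
  ∑ (upTo b) fromℕ ℚ.* recip b               ≡⟨ cong (ℚ._* recip b) (gauss m) ⟩
  fromℕ b ℚ.* (fromℕ m ℚ.* ℚ.½) ℚ.* recip b  ≡⟨ solve 3 (λ x y z → x :* y :* z := x :* z :* y) refl (fromℕ b) _ (recip b) ⟩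
  fromℕ b ℚ.* recip b ℚ.* (fromℕ m ℚ.* ℚ.½)  ≡⟨ cong (ℚ._* (fromℕ m ℚ.* ℚ.½)) (fromℕ-recip b) ⟩
  1ℚ ℚ.* (fromℕ m ℚ.* ℚ.½)                   ≡⟨ ℚ.*-identityˡ _ ⟩
  fromℕ m ℚ.* ℚ.½                            ≡⟨ /-split m 2 ⟨
  + m / 2                                    ∎
  where
  open ≡-Reasoning
  open FiniteSum ℚ.+-0-rawMonoid
  open ℚSums
  open ℚ.+-*-Solver

  gauss : ∀ m → ∑ (upTo (suc m)) fromℕ ≡ fromℕ (suc m) ℚ.* (fromℕ m ℚ.* ℚ.½)
  gauss zero    = refl
  gauss (suc m) = begin
    ∑ (upTo (suc (suc m))) fromℕ                            ≡⟨ ∑-upTo-∷ʳ (suc m) fromℕ ⟩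
    ∑ (upTo (suc m)) fromℕ ℚ.+ fromℕ (suc m)                ≡⟨ cong (ℚ._+ fromℕ (suc m)) (gauss m) ⟩
    fromℕ (suc m) ℚ.* (fromℕ m ℚ.* ℚ.½) ℚ.+ fromℕ (suc m)
      ≡⟨ cong (λ x → x ℚ.* (fromℕ m ℚ.* ℚ.½) ℚ.+ x) (fromℕ-suc m) ⟩
    (1ℚ ℚ.+ fromℕ m) ℚ.* (fromℕ m ℚ.* ℚ.½) ℚ.+ (1ℚ ℚ.+ fromℕ m)
      ≡⟨ solve 1 (λ x → (con 1ℚ :+ x) :* (x :* con ℚ.½) :+ (con 1ℚ :+ x)
                     := (con 1ℚ :+ (con 1ℚ :+ x)) :* ((con 1ℚ :+ x) :* con ℚ.½)) refl (fromℕ m) ⟩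
    (1ℚ ℚ.+ (1ℚ ℚ.+ fromℕ m)) ℚ.* ((1ℚ ℚ.+ fromℕ m) ℚ.* ℚ.½)
      ≡⟨ cong (λ x → (1ℚ ℚ.+ x) ℚ.* (x ℚ.* ℚ.½)) (fromℕ-suc m) ⟨
    (1ℚ ℚ.+ fromℕ (suc m)) ℚ.* (fromℕ (suc m) ℚ.* ℚ.½)
      ≡⟨ cong (ℚ._* (fromℕ (suc m) ℚ.* ℚ.½)) (fromℕ-suc (suc m)) ⟨
    fromℕ (suc (suc m)) ℚ.* (fromℕ (suc m) ℚ.* ℚ.½)         ∎

/-+1 : ∀ k d .{{_ : NonZero d}} → (+ k / d) ℚ.+ 1ℚ ≡ + (k ℕ.+ d) / d
/-+1 k d = begin
  (+ k / d) ℚ.+ 1ℚ                                 ≡⟨ cong₂ ℚ._+_ (/-split k d) (sym (fromℕ-recip d)) ⟩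
  fromℕ k ℚ.* recip d ℚ.+ fromℕ d ℚ.* recip d      ≡⟨ ℚ.*-distribʳ-+ (recip d) (fromℕ k) (fromℕ d) ⟨
  (fromℕ k ℚ.+ fromℕ d) ℚ.* recip d                ≡⟨ cong (ℚ._* recip d) (fromℕ-+ k d) ⟨
  fromℕ (k ℕ.+ d) ℚ.* recip d                      ≡⟨ /-split (k ℕ.+ d) d ⟨
  + (k ℕ.+ d) / d                                  ∎
  where open ≡-Reasoning

module Reciprocity {c ℓ} (K : ℚAlgebra c ℓ) (a b : ℕ) .{{_ : NonZero a}} .{{_ : NonZero b}} where
  open ℚAlgebra K renaming (refl to ≈-refl; sym to ≈-sym; trans to ≈-trans)
  open Sums commutativeSemiring
  open ≈-Reasoning setoid
  open ℚAlgebraSolver K using (solve; _:=_; _:+_; _:*_; _:-_; con)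
  private
    module ι = RingMorphisms.IsRingHomomorphism ι-isRingHomomorphism

    instance
      ab≢0 : NonZero (a ℕ.* b)
      ab≢0 = m*n≢0 a b

  ι-∑ : ∀ ks (g : ℕ → ℚ) → ι (FiniteSum.∑ ℚ.+-0-rawMonoid ks g) ≈ ∑[ k ∈ ks ] ι (g k)
  ι-∑ []       g = ι.0#-homo
  ι-∑ (k ∷ ks) g = ≈-trans (ι.+-homo _ _) (+-congˡ (ι-∑ ks g))

  -- The way a functional equation enters a weighted sum: its constant β meets only the sum of the
  -- weights.
  ∑-affine : ∀ n {w g h : ℕ → Carrier} {α β} → (∀ i → i < n → g i ≈ α * h i + β) →
             ∑[ i ∈ upTo n ] w i * g i ≈ α * (∑[ i ∈ upTo n ] w i * h i) + β * ∑ (upTo n) w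
  ∑-affine n {w} {g} {h} {α} {β} g≈ = begin
    (∑[ i ∈ upTo n ] w i * g i)
      ≈⟨ ∑-cong-< n (λ i i<n → ≈-trans (*-congˡ (g≈ i i<n))
           (solve 4 (λ α β w h → w :* (α :* h :+ β) := α :* (w :* h) :+ β :* w) ≈-refl α β (w i) (h i))) ⟩
    (∑[ i ∈ upTo n ] (α * (w i * h i) + β * w i))
      ≈⟨ ∑-+ (upTo n) _ _ ⟩
    (∑[ i ∈ upTo n ] α * (w i * h i)) + (∑[ i ∈ upTo n ] β * w i)
      ≈⟨ +-cong (*-∑ α (upTo n) _) (*-∑ β (upTo n) w) ⟨
    α * (∑[ i ∈ upTo n ] w i * h i) + β * ∑ (upTo n) w ∎

  module _ (coprime : Coprime a b) (αa αb βa βb : Carrier) (f : ℚ → Carrier)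
    (f-a : ∀ i → i < b →
       f (+ (i ℕ.* a) / b) ≈ αa * (∑[ j ∈ upTo a ] f ((+ i / b) ℚ.+ (+ j / a))) + βa)
    (f-b : ∀ j → j < a →
       f (+ (j ℕ.* b) / a) ≈ αb * (∑[ i ∈ upTo b ] f ((+ i / b) ℚ.+ (+ j / a))) + βb)
    where

    private
      G : ℚ → Carrier
      G x = ι x * f x

      x : ℕ → ℕ → ℚ
      x i j = (+ i / b) ℚ.+ (+ j / a)

      x≡ : ∀ i j → x i j ≡ + (i ℕ.* a ℕ.+ j ℕ.* b) / (a ℕ.* b)
      x≡ i j = trans (/-+-ℕ i j b a) (ℚ./-cong {+ (i ℕ.* a ℕ.+ j ℕ.* b)} {{m*n≢0 b a}} refl (ℕ.*-comm b a))

      rows columns L gapSum : Carrier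
      rows    = ∑[ i ∈ upTo b ] ι (+ i / b) * (∑[ j ∈ upTo a ] f (x i j))
      columns = ∑[ j ∈ upTo a ] ι (+ j / a) * (∑[ i ∈ upTo b ] f (x i j))
      L       = αb * (∑[ i ∈ upTo b ] ι (+ i / b) * f (+ (i ℕ.* a) / b))
                + αa * (∑[ j ∈ upTo a ] ι (+ j / a) * f (+ (j ℕ.* b) / a))
      gapSum  = ∑[ k ∈ gaps a b ] (G ((+ k / (a ℕ.* b)) ℚ.+ 1ℚ) - G (+ k / (a ℕ.* b)))

      -- The weights i/b and j/a of the two sums add up to the argument `x i j` itself, so both sums
      -- merge into one of the form Σ x f(x).
      rows+columns : rows + columns ≈ ∑[ i ∈ upTo b ] (∑[ j ∈ upTo a ] G (x i j))
      rows+columns = begin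
        rows + columns
          ≈⟨ +-cong (∑-cong (upTo b) (λ i → *-∑ _ (upTo a) _)) (∑-cong (upTo a) (λ j → *-∑ _ (upTo b) _)) ⟩
        (∑[ i ∈ upTo b ] (∑[ j ∈ upTo a ] ι (+ i / b) * f (x i j)))
          + (∑[ j ∈ upTo a ] (∑[ i ∈ upTo b ] ι (+ j / a) * f (x i j)))
          ≈⟨ +-congˡ (∑-swap (upTo a) (upTo b) _) ⟩
        (∑[ i ∈ upTo b ] (∑[ j ∈ upTo a ] ι (+ i / b) * f (x i j)))
          + (∑[ i ∈ upTo b ] (∑[ j ∈ upTo a ] ι (+ j / a) * f (x i j)))
          ≈⟨ ∑-+ (upTo b) _ _ ⟨
        (∑[ i ∈ upTo b ] ((∑[ j ∈ upTo a ] ι (+ i / b) * f (x i j))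
                          + (∑[ j ∈ upTo a ] ι (+ j / a) * f (x i j))))
          ≈⟨ ∑-cong (upTo b) (λ i → ∑-+ (upTo a) _ _) ⟨
        (∑[ i ∈ upTo b ] (∑[ j ∈ upTo a ] (ι (+ i / b) * f (x i j) + ι (+ j / a) * f (x i j))))
          ≈⟨ ∑-cong (upTo b) (λ i → ∑-cong (upTo a) (λ j →
               ≈-trans (≈-sym (distribʳ _ _ _)) (*-congʳ (≈-sym (ι.+-homo _ _))))) ⟩
        (∑[ i ∈ upTo b ] (∑[ j ∈ upTo a ] G (x i j))) ∎

      double-sum : ∑[ i ∈ upTo b ] (∑[ j ∈ upTo a ] G (x i j))
                   ≈ gapSum + (∑[ k ∈ upTo (a ℕ.* b) ] G (+ k / (a ℕ.* b)))
      double-sum = begin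
        -- The sum g over the gaps is added and subtracted because `∑-combinations` carries it on
        -- the left.
        D                     ≈⟨ solve 2 (λ d g → d := (d :+ g) :- g) ≈-refl D g ⟩
        D + g - g             ≈⟨ +-congʳ (+-congʳ (∑-cong (upTo b) (λ i → ∑-cong (upTo a) (λ j → reflexive (cong G (x≡ i j)))))) ⟩
        (∑[ i ∈ upTo b ] (∑[ j ∈ upTo a ] G (+ (i ℕ.* a ℕ.+ j ℕ.* b) / (a ℕ.* b)))) + g - g
                              ≈⟨ +-congʳ (∑-combinations a b coprime commutativeSemiring (λ k → G (+ k / (a ℕ.* b)))) ⟩
        s + T - g             ≈⟨ +-congʳ (+-congʳ shifted) ⟩
        gapSum + g + T - g    ≈⟨ solve 3 (λ h g t → h :+ g :+ t :- g := h :+ t) ≈-refl gapSum g T ⟩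
        gapSum + T            ∎
        where
        D = ∑[ i ∈ upTo b ] (∑[ j ∈ upTo a ] G (x i j))
        g = ∑[ k ∈ gaps a b ] G (+ k / (a ℕ.* b))
        s = ∑[ k ∈ gaps a b ] G (+ (k ℕ.+ a ℕ.* b) / (a ℕ.* b))
        T = ∑[ k ∈ upTo (a ℕ.* b) ] G (+ k / (a ℕ.* b))

        shifted : s ≈ gapSum + g
        shifted = ≈-trans
          (∑-cong (gaps a b) (λ k → ≈-trans (reflexive (cong G (sym (/-+1 k (a ℕ.* b)))))
             (solve 2 (λ p q → p := (p :- q) :+ q) ≈-refl _ _)))
          (∑-+ (gaps a b) _ _)

    reciprocity : L ≈ αa * αb * gapSum
                      + αa * αb * (∑[ k ∈ upTo (a ℕ.* b) ] G (+ k / (a ℕ.* b)))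
                      + αb * βa * ι (+ (b ℕ.∸ 1) / 2)
                      + αa * βb * ι (+ (a ℕ.∸ 1) / 2)
    reciprocity = begin
      L
        ≈⟨ +-cong (*-congˡ (∑-affine b f-a)) (*-congˡ (∑-affine a f-b)) ⟩
      αb * (αa * rows + βa * (∑[ i ∈ upTo b ] ι (+ i / b)))
        + αa * (αb * columns + βb * (∑[ j ∈ upTo a ] ι (+ j / a)))
        ≈⟨ +-cong (*-congˡ (+-congˡ (*-congˡ (half b)))) (*-congˡ (+-congˡ (*-congˡ (half a)))) ⟩
      αb * (αa * rows + βa * ι (+ (b ℕ.∸ 1) / 2))
        + αa * (αb * columns + βb * ι (+ (a ℕ.∸ 1) / 2))
        ≈⟨ solve 8 (λ αa αb βa βb r c hb ha →
               αb :* (αa :* r :+ βa :* hb) :+ αa :* (αb :* c :+ βb :* ha)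
               := αa :* αb :* (r :+ c) :+ αb :* βa :* hb :+ αa :* βb :* ha) ≈-refl
             αa αb βa βb rows columns (ι (+ (b ℕ.∸ 1) / 2)) (ι (+ (a ℕ.∸ 1) / 2)) ⟩
      αa * αb * (rows + columns) + αb * βa * ι (+ (b ℕ.∸ 1) / 2) + αa * βb * ι (+ (a ℕ.∸ 1) / 2)
        ≈⟨ +-congʳ (+-congʳ (≈-trans (*-congˡ (≈-trans rows+columns double-sum)) (distribˡ _ _ _))) ⟩
      αa * αb * gapSum + αa * αb * (∑[ k ∈ upTo (a ℕ.* b) ] G (+ k / (a ℕ.* b)))
        + αb * βa * ι (+ (b ℕ.∸ 1) / 2) + αa * βb * ι (+ (a ℕ.∸ 1) / 2) ∎
      where
      half : ∀ d .{{_ : NonZero d}} → ∑[ i ∈ upTo d ] ι (+ i / d) ≈ ι (+ (d ℕ.∸ 1) / 2)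
      half d = ≈-trans (≈-sym (ι-∑ (upTo d) (λ i → + i / d))) (reflexive (cong ι (∑-fractions d)))

    -- When f(y + 1) = f(y), each difference (y + 1) f(y + 1) - y f(y) in the gap sum collapses to
    -- f(y).
    reciprocity-periodic : (∀ y → f (y ℚ.+ 1ℚ) ≈ f y) →
      L ≈ αa * αb * (∑[ k ∈ gaps a b ] f (+ k / (a ℕ.* b)))
          + αa * αb * (∑[ k ∈ upTo (a ℕ.* b) ] G (+ k / (a ℕ.* b)))
          + αb * βa * ι (+ (b ℕ.∸ 1) / 2)
          + αa * βb * ι (+ (a ℕ.∸ 1) / 2)
    reciprocity-periodic f-periodic = ≈-trans reciprocity
      (+-congʳ (+-congʳ (+-congʳ (*-congˡ (∑-cong (gaps a b) (λ k → step (+ k / (a ℕ.* b))))))))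
      where
      step : ∀ y → G (y ℚ.+ 1ℚ) - G y ≈ f y
      step y = begin
        ι (y ℚ.+ 1ℚ) * f (y ℚ.+ 1ℚ) - ι y * f y
          ≈⟨ +-congʳ (*-cong (≈-trans (ι.+-homo y 1ℚ) (+-congˡ ι.1#-homo)) (f-periodic y)) ⟩
        (ι y + 1#) * f y - ι y * f y
          -- The constants of the solver are images of rationals, so `1#` is replaced by `ι 1ℚ`.
          ≈⟨ +-congʳ (*-congʳ (+-congˡ (≈-sym ι.1#-homo))) ⟩
        (ι y + ι 1ℚ) * f y - ι y * f y
          ≈⟨ solve 2 (λ p q → (p :+ con 1ℚ) :* q :- p :* q := q) ≈-refl (ι y) (f y) ⟩
        f y ∎

-- Formal power series over ℚ

open RawSemiringDefs ℚ.+-*-rawSemiring using (_^_)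

-- The Cauchy product, by recursion on the tail of the first factor: no index is subtracted, and
-- inductions over it are structural.
conv : (ℕ → ℚ) → (ℕ → ℚ) → ℕ → ℚ
conv f g zero    = f 0 ℚ.* g 0
conv f g (suc n) = f 0 ℚ.* g (suc n) ℚ.+ conv (f ∘ suc) g n

module _ where
  open ≡-Reasoning
  open ℚ.+-*-Solver

  conv-cong : ∀ {f f′ g g′ : ℕ → ℚ} → (∀ n → f n ≡ f′ n) → (∀ n → g n ≡ g′ n) →
              ∀ n → conv f g n ≡ conv f′ g′ n
  conv-cong f≡ g≡ zero    = cong₂ ℚ._*_ (f≡ 0) (g≡ 0)
  conv-cong f≡ g≡ (suc n) = cong₂ ℚ._+_ (cong₂ ℚ._*_ (f≡ 0) (g≡ (suc n)))
    (conv-cong (λ m → f≡ (suc m)) g≡ n)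

  -- The recursion from the other end, peeling the second factor; commutativity is the comparison of
  -- the two.
  conv-suc : ∀ f g n → conv f g (suc n) ≡ conv f (g ∘ suc) n ℚ.+ f (suc n) ℚ.* g 0
  conv-suc f g zero    = refl
  conv-suc f g (suc n) = begin
    f 0 ℚ.* g (2 ℕ.+ n) ℚ.+ conv (f ∘ suc) g (suc n)
      ≡⟨ cong (f 0 ℚ.* g (2 ℕ.+ n) ℚ.+_) (conv-suc (f ∘ suc) g n) ⟩
    f 0 ℚ.* g (2 ℕ.+ n) ℚ.+ (conv (f ∘ suc) (g ∘ suc) n ℚ.+ f (2 ℕ.+ n) ℚ.* g 0)
      ≡⟨ ℚ.+-assoc (f 0 ℚ.* g (2 ℕ.+ n)) _ _ ⟨
    f 0 ℚ.* g (2 ℕ.+ n) ℚ.+ conv (f ∘ suc) (g ∘ suc) n ℚ.+ f (2 ℕ.+ n) ℚ.* g 0 ∎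

  conv-comm : ∀ f g n → conv f g n ≡ conv g f n
  conv-comm f g zero    = ℚ.*-comm (f 0) (g 0)
  conv-comm f g (suc n) = begin
    f 0 ℚ.* g (suc n) ℚ.+ conv (f ∘ suc) g n  ≡⟨ cong₂ ℚ._+_ (ℚ.*-comm (f 0) _) (conv-comm (f ∘ suc) g n) ⟩
    g (suc n) ℚ.* f 0 ℚ.+ conv g (f ∘ suc) n  ≡⟨ ℚ.+-comm (g (suc n) ℚ.* f 0) _ ⟩
    conv g (f ∘ suc) n ℚ.+ g (suc n) ℚ.* f 0  ≡⟨ conv-suc g f n ⟨
    conv g f (suc n)                          ∎

  conv-+ : ∀ f g h n → conv (λ m → f m ℚ.+ g m) h n ≡ conv f h n ℚ.+ conv g h n
  conv-+ f g h zero    = ℚ.*-distribʳ-+ (h 0) (f 0) (g 0)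
  conv-+ f g h (suc n) = trans
    (cong ((f 0 ℚ.+ g 0) ℚ.* h (suc n) ℚ.+_) (conv-+ (f ∘ suc) (g ∘ suc) h n))
    (solve 5 (λ x y z s t → (x :+ y) :* z :+ (s :+ t) := (x :* z :+ s) :+ (y :* z :+ t)) refl
      (f 0) (g 0) (h (suc n)) _ _)

  conv-* : ∀ c f h n → conv (λ m → c ℚ.* f m) h n ≡ c ℚ.* conv f h n
  conv-* c f h zero    = ℚ.*-assoc c (f 0) (h 0)
  conv-* c f h (suc n) = trans
    (cong (c ℚ.* f 0 ℚ.* h (suc n) ℚ.+_) (conv-* c (f ∘ suc) h n))
    (solve 4 (λ c x y s → c :* x :* y :+ c :* s := c :* (x :* y :+ s)) refl c (f 0) (h (suc n)) _)

  conv-assoc : ∀ f g h n → conv (conv f g) h n ≡ conv f (conv g h) n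
  conv-assoc f g h zero    = ℚ.*-assoc (f 0) (g 0) (h 0)
  conv-assoc f g h (suc n) = begin
    f 0 ℚ.* g 0 ℚ.* h (suc n) ℚ.+ conv (λ m → f 0 ℚ.* g (suc m) ℚ.+ conv (f ∘ suc) g m) h n
      ≡⟨ cong (f 0 ℚ.* g 0 ℚ.* h (suc n) ℚ.+_) (trans
           (conv-+ (λ m → f 0 ℚ.* g (suc m)) (conv (f ∘ suc) g) h n)
           (cong₂ ℚ._+_ (conv-* (f 0) (g ∘ suc) h n) (conv-assoc (f ∘ suc) g h n))) ⟩
    f 0 ℚ.* g 0 ℚ.* h (suc n) ℚ.+ (f 0 ℚ.* conv (g ∘ suc) h n ℚ.+ conv (f ∘ suc) (conv g h) n)
      ≡⟨ solve 5 (λ x y z s t → x :* y :* z :+ (x :* s :+ t) := x :* (y :* z :+ s) :+ t) refl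
           (f 0) (g 0) (h (suc n)) _ _ ⟩
    f 0 ℚ.* (g 0 ℚ.* h (suc n) ℚ.+ conv (g ∘ suc) h n) ℚ.+ conv (f ∘ suc) (conv g h) n ∎

  conv-0 : ∀ h n → conv (λ _ → ℚ.0ℚ) h n ≡ ℚ.0ℚ
  conv-0 h zero    = ℚ.*-zeroˡ (h 0)
  conv-0 h (suc n) = cong₂ ℚ._+_ (ℚ.*-zeroˡ (h (suc n))) (conv-0 h n)

  conv-explicit : ∀ f g n → conv f g n ≡ FiniteSum.∑ ℚ.+-0-rawMonoid (upTo (suc n)) (λ i → f i ℚ.* g (n ℕ.∸ i))
  conv-explicit f g zero    = sym (ℚ.+-identityʳ (f 0 ℚ.* g 0))
  conv-explicit f g (suc n) = trans
    (cong (f 0 ℚ.* g (suc n) ℚ.+_) (conv-explicit (f ∘ suc) g n))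
    (sym (ℚSums.∑-upTo-suc (suc n) (λ i → f i ℚ.* g (suc n ℕ.∸ i))))

  -- The Leibniz rule for t d/dt: in a product term of degree n the two degrees add up to n.
  conv-θ : ∀ f g n → fromℕ n ℚ.* conv f g n ≡
           conv (λ m → fromℕ m ℚ.* f m) g n ℚ.+ conv f (λ m → fromℕ m ℚ.* g m) n
  conv-θ f g zero    = solve 2 (λ x y → con ℚ.0ℚ :* (x :* y) := con ℚ.0ℚ :* x :* y :+ x :* (con ℚ.0ℚ :* y)) refl (f 0) (g 0)
  conv-θ f g (suc n) = begin
    s ℚ.* (f 0 ℚ.* g (suc n) ℚ.+ c)
      ≡⟨ cong (λ k → k ℚ.* (f 0 ℚ.* g (suc n) ℚ.+ c)) (fromℕ-suc n) ⟩
    (1ℚ ℚ.+ fromℕ n) ℚ.* (f 0 ℚ.* g (suc n) ℚ.+ c)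
      ≡⟨ solve 4 (λ k x y c → (con 1ℚ :+ k) :* (x :* y :+ c) := x :* ((con 1ℚ :+ k) :* y) :+ (c :+ k :* c)) refl
           (fromℕ n) (f 0) (g (suc n)) c ⟩
    f 0 ℚ.* ((1ℚ ℚ.+ fromℕ n) ℚ.* g (suc n)) ℚ.+ (c ℚ.+ fromℕ n ℚ.* c)
      ≡⟨ cong₂ (λ k d → f 0 ℚ.* (k ℚ.* g (suc n)) ℚ.+ (c ℚ.+ d)) (sym (fromℕ-suc n)) (conv-θ (f ∘ suc) g n) ⟩
    f 0 ℚ.* (s ℚ.* g (suc n)) ℚ.+ (c ℚ.+ (d ℚ.+ e))
      -- The vanishing summand is the index 0 term of the first convolution on the right. The part c
      -- + d is its tail, because f(m + 1) + m f(m + 1) = (m + 1) f(m + 1).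
      ≡⟨ solve 5 (λ x y c d e → x :* y :+ (c :+ (d :+ e)) := (con ℚ.0ℚ :* x :* y) :+ (c :+ d) :+ (x :* y :+ e)) refl
           (f 0) (s ℚ.* g (suc n)) c d e ⟩
    ℚ.0ℚ ℚ.* f 0 ℚ.* (s ℚ.* g (suc n)) ℚ.+ (c ℚ.+ d) ℚ.+ (f 0 ℚ.* (s ℚ.* g (suc n)) ℚ.+ e)
      ≡⟨ cong (ℚ._+ (f 0 ℚ.* (s ℚ.* g (suc n)) ℚ.+ e)) (cong₂ ℚ._+_
           (solve 3 (λ x s y → con ℚ.0ℚ :* x :* (s :* y) := con ℚ.0ℚ :* x :* y) refl (f 0) s (g (suc n)))
           (trans (sym (conv-+ (f ∘ suc) (λ m → fromℕ m ℚ.* f (suc m)) g n))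
             (conv-cong (λ m → trans
               (solve 2 (λ k y → y :+ k :* y := (con 1ℚ :+ k) :* y) refl (fromℕ m) (f (suc m)))
               (cong (ℚ._* f (suc m)) (sym (fromℕ-suc m)))) (λ _ → refl) n))) ⟩
    conv (λ m → fromℕ m ℚ.* f m) g (suc n) ℚ.+ conv f (λ m → fromℕ m ℚ.* g m) (suc n) ∎
    where
    s = fromℕ (suc n)
    c = conv (f ∘ suc) g n
    d = conv (λ m → fromℕ m ℚ.* f (suc m)) g n
    e = conv (f ∘ suc) (λ m → fromℕ m ℚ.* g m) n

  -- The substitution of ct for t is multiplicative, since the powers of c split with the degrees.
  conv-σ : ∀ c f g n → c ^ n ℚ.* conv f g n ≡ conv (λ m → c ^ m ℚ.* f m) (λ m → c ^ m ℚ.* g m) n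
  conv-σ c f g zero    = solve 2 (λ x y → con 1ℚ :* (x :* y) := con 1ℚ :* x :* (con 1ℚ :* y)) refl (f 0) (g 0)
  conv-σ c f g (suc n) = begin
    c ^ suc n ℚ.* (f 0 ℚ.* g (suc n) ℚ.+ conv (f ∘ suc) g n)
      ≡⟨ solve 5 (λ c p x y s → (c :* p) :* (x :* y :+ s) := con 1ℚ :* x :* (c :* p :* y) :+ c :* (p :* s)) refl
           c (c ^ n) (f 0) (g (suc n)) _ ⟩
    1ℚ ℚ.* f 0 ℚ.* (c ^ suc n ℚ.* g (suc n)) ℚ.+ c ℚ.* (c ^ n ℚ.* conv (f ∘ suc) g n)
      ≡⟨ cong (λ s → 1ℚ ℚ.* f 0 ℚ.* (c ^ suc n ℚ.* g (suc n)) ℚ.+ s) (begin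
           c ℚ.* (c ^ n ℚ.* conv (f ∘ suc) g n)               ≡⟨ cong (c ℚ.*_) (conv-σ c (f ∘ suc) g n) ⟩
           c ℚ.* conv (λ m → c ^ m ℚ.* f (suc m)) σg n        ≡⟨ conv-* c _ σg n ⟨
           conv (λ m → c ℚ.* (c ^ m ℚ.* f (suc m))) σg n      ≡⟨ conv-cong (λ m → sym (ℚ.*-assoc c (c ^ m) (f (suc m)))) (λ _ → refl) n ⟩
           conv (λ m → c ^ suc m ℚ.* f (suc m)) σg n          ∎) ⟩
    conv (λ m → c ^ m ℚ.* f m) σg (suc n) ∎
    where
    σg = λ m → c ^ m ℚ.* g m

  -- A series u with constant term 1 is no zero divisor: coefficient 0 of the product gives d(0) =
  -- 0, and then the tail of d satisfies the same hypothesis.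
  conv-zero-divisor : ∀ {u} → u 0 ≡ 1ℚ → ∀ n d → (∀ m → conv d u m ≡ ℚ.0ℚ) → d n ≡ ℚ.0ℚ
  conv-zero-divisor {u} u0≡1 zero    d du≡0 = begin
    d 0              ≡⟨ ℚ.*-identityʳ (d 0) ⟨
    d 0 ℚ.* 1ℚ       ≡⟨ cong (d 0 ℚ.*_) u0≡1 ⟨
    d 0 ℚ.* u 0      ≡⟨ du≡0 0 ⟩
    ℚ.0ℚ             ∎
  conv-zero-divisor {u} u0≡1 (suc n) d du≡0 = conv-zero-divisor u0≡1 n (d ∘ suc) λ m → begin
    conv (d ∘ suc) u m                                ≡⟨ ℚ.+-identityˡ _ ⟨
    ℚ.0ℚ ℚ.+ conv (d ∘ suc) u m                       ≡⟨ cong (ℚ._+ conv (d ∘ suc) u m) (ℚ.*-zeroˡ (u (suc m))) ⟨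
    ℚ.0ℚ ℚ.* u (suc m) ℚ.+ conv (d ∘ suc) u m         ≡⟨ cong (λ x → x ℚ.* u (suc m) ℚ.+ conv (d ∘ suc) u m) (conv-zero-divisor u0≡1 0 d du≡0) ⟨
    conv d u (suc m)                                  ≡⟨ du≡0 (suc m) ⟩
    ℚ.0ℚ                                              ∎

-- Without eta, and with equality a record, unification does not unfold series expressions.
record Series : Set where
  no-eta-equality
  constructor series
  field coeff : ℕ → ℚ

open Series

infix 4 _≗ₛ_
record _≗ₛ_ (f g : Series) : Set where
  constructor mk≗
  field at : ∀ n → coeff f n ≡ coeff g n

open _≗ₛ_

infixl 6 _+ₛ_
infixl 7 _*ₛ_

_+ₛ_ _*ₛ_ : Series → Series → Series
coeff (f +ₛ g) n = coeff f n ℚ.+ coeff g n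
coeff (f *ₛ g)   = conv (coeff f) (coeff g)

-ₛ_ : Series → Series
coeff (-ₛ f) n = ℚ.- coeff f n

const : ℚ → Series
coeff (const c) zero    = c
coeff (const c) (suc n) = ℚ.0ℚ

const-*ₛ : ∀ c f n → coeff (const c *ₛ f) n ≡ c ℚ.* coeff f n
const-*ₛ c f zero    = refl
const-*ₛ c f (suc n) = trans (cong (c ℚ.* coeff f (suc n) ℚ.+_)
  (trans (conv-cong (λ _ → refl) (λ _ → refl) n) (conv-0 (coeff f) n))) (ℚ.+-identityʳ _)

0-coeff : ∀ n → coeff (const ℚ.0ℚ) n ≡ ℚ.0ℚ
0-coeff zero    = refl
0-coeff (suc n) = refl

series-commutativeRing : CommutativeRing 0ℓ 0ℓ
series-commutativeRing = record
  { Carrier = Series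
  ; _≈_     = _≗ₛ_
  ; _+_     = _+ₛ_
  ; _*_     = _*ₛ_
  ; -_      = -ₛ_
  ; 0#      = const ℚ.0ℚ
  ; 1#      = const 1ℚ
  ; isCommutativeRing = record
    { isRing = record
      { +-isAbelianGroup = record
        { isGroup = record
          { isMonoid = record
            { isSemigroup = record
              { isMagma = record
                { isEquivalence = record
                  { refl  = mk≗ λ _ → refl
                  ; sym   = λ f≈g → mk≗ λ n → sym (at f≈g n)
                  ; trans = λ f≈g g≈h → mk≗ λ n → trans (at f≈g n) (at g≈h n)
                  }
                ; ∙-cong = λ f≈ g≈ → mk≗ λ n → cong₂ ℚ._+_ (at f≈ n) (at g≈ n)
                }
              ; assoc = λ f g h → mk≗ λ n → ℚ.+-assoc (coeff f n) (coeff g n) (coeff h n)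
              }
            ; identity =
                (λ f → mk≗ λ n → trans (cong (ℚ._+ coeff f n) (0-coeff n)) (ℚ.+-identityˡ _)) ,
                (λ f → mk≗ λ n → trans (cong (coeff f n ℚ.+_) (0-coeff n)) (ℚ.+-identityʳ _))
            }
          ; inverse =
              (λ f → mk≗ λ n → trans (ℚ.+-inverseˡ (coeff f n)) (sym (0-coeff n))) ,
              (λ f → mk≗ λ n → trans (ℚ.+-inverseʳ (coeff f n)) (sym (0-coeff n)))
          ; ⁻¹-cong = λ f≈g → mk≗ λ n → cong ℚ.-_ (at f≈g n)
          }
        ; comm = λ f g → mk≗ λ n → ℚ.+-comm (coeff f n) (coeff g n)
        }
      ; *-cong     = λ f≈ g≈ → mk≗ (conv-cong (at f≈) (at g≈))
      ; *-assoc    = λ f g h → mk≗ (conv-assoc (coeff f) (coeff g) (coeff h))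
      ; *-identity = *ₛ-identityˡ , *ₛ-identityʳ
      ; distrib    = *ₛ-distribˡ , λ f g h → mk≗ (*ₛ-distribʳ f g h)
      }
    ; *-comm = *ₛ-comm
    }
  }
  where
  *ₛ-comm : ∀ f g → f *ₛ g ≗ₛ g *ₛ f
  *ₛ-comm f g = mk≗ (conv-comm (coeff f) (coeff g))

  *ₛ-identityˡ : ∀ f → const 1ℚ *ₛ f ≗ₛ f
  *ₛ-identityˡ f = mk≗ λ n → trans (const-*ₛ 1ℚ f n) (ℚ.*-identityˡ (coeff f n))

  *ₛ-identityʳ : ∀ f → f *ₛ const 1ℚ ≗ₛ f
  *ₛ-identityʳ f = mk≗ λ n → trans (at (*ₛ-comm f (const 1ℚ)) n) (at (*ₛ-identityˡ f) n)

  *ₛ-distribʳ : ∀ f g h n → coeff ((g +ₛ h) *ₛ f) n ≡ coeff (g *ₛ f +ₛ h *ₛ f) n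
  *ₛ-distribʳ f g h n = trans (conv-cong (λ _ → refl) (λ _ → refl) n)
    (conv-+ (coeff g) (coeff h) (coeff f) n)

  *ₛ-distribˡ : ∀ f g h → f *ₛ (g +ₛ h) ≗ₛ f *ₛ g +ₛ f *ₛ h
  *ₛ-distribˡ f g h = mk≗ λ n → trans (at (*ₛ-comm f (g +ₛ h)) n) (trans (*ₛ-distribʳ f g h n)
    (cong₂ ℚ._+_ (at (*ₛ-comm g f) n) (at (*ₛ-comm h f) n)))

-- Rationals embed as constant series, which makes the solver available for series with rational
-- constants.
series-ℚAlgebra : ℚAlgebra 0ℓ 0ℓ
series-ℚAlgebra = record
  { commutativeRing      = series-commutativeRing
  ; ι                    = const
  ; ι-isRingHomomorphism = record
    { isSemiringHomomorphism = record
      { isNearSemiringHomomorphism = record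
        { +-isMonoidHomomorphism = record
          { isMagmaHomomorphism = record
            { isRelHomomorphism = record { cong = λ { refl → mk≗ λ _ → refl } }
            ; homo = λ p q → mk≗ λ { zero → refl ; (suc n) → refl }
            }
          ; ε-homo = mk≗ λ _ → refl
          }
        ; *-homo = λ p q → mk≗ λ { zero → refl
                                 ; (suc n) → sym (trans (const-*ₛ p (const q) (suc n)) (ℚ.*-zeroʳ p)) }
        }
      ; 1#-homo = mk≗ λ _ → refl
      }
    ; -‿homo = λ p → mk≗ λ { zero → refl ; (suc n) → refl }
    }
  }

module SeriesRing where
  open ℚAlgebra series-ℚAlgebra public hiding (zero)
    renaming (refl to ≈-refl; sym to ≈-sym; trans to ≈-trans)
  open Sums commutativeSemiring public
  open ℚAlgebraSolver series-ℚAlgebra using (solve; _:=_; _:+_; _:*_; _:-_; :-_; con) public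

-- The indeterminate t, the operator t d/dt and the exponential series

X : Series
coeff X zero          = ℚ.0ℚ
coeff X (suc zero)    = 1ℚ
coeff X (suc (suc n)) = ℚ.0ℚ

θ : Series → Series
coeff (θ f) n = fromℕ n ℚ.* coeff f n

-- The substitution f(t) ↦ f(ct).
σ : ℚ → Series → Series
coeff (σ c f) n = c ^ n ℚ.* coeff f n

-- The number xⁿ/n!, given by the recursion that the differential equation of eˣᵗ dictates.
expCoeff : ℚ → ℕ → ℚ
expCoeff x zero    = 1ℚ
expCoeff x (suc n) = x ℚ.* recip (suc n) ℚ.* expCoeff x n

exp : ℚ → Series
coeff (exp x) = expCoeff x

coeff-X* : ∀ f n → coeff (X *ₛ f) (suc n) ≡ coeff f n
coeff-X* f n = begin
  ℚ.0ℚ ℚ.* coeff f (suc n) ℚ.+ conv (coeff X ∘ suc) (coeff f) n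
    ≡⟨ cong₂ ℚ._+_ (ℚ.*-zeroˡ (coeff f (suc n)))
         (conv-cong {coeff X ∘ suc} {coeff (const 1ℚ)} {coeff f} (λ { zero → refl ; (suc m) → refl }) (λ _ → refl) n) ⟩
  ℚ.0ℚ ℚ.+ conv (coeff (const 1ℚ)) (coeff f) n    ≡⟨ ℚ.+-identityˡ _ ⟩
  conv (coeff (const 1ℚ)) (coeff f) n             ≡⟨ const-*ₛ 1ℚ f n ⟩
  1ℚ ℚ.* coeff f n                                ≡⟨ ℚ.*-identityˡ _ ⟩
  coeff f n                                       ∎
  where open ≡-Reasoning

coeff-∑ : ∀ ks (F : ℕ → Series) n →
          coeff (SeriesRing.∑ ks F) n ≡ FiniteSum.∑ ℚ.+-0-rawMonoid ks (λ k → coeff (F k) n)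
coeff-∑ []       F n = 0-coeff n
coeff-∑ (k ∷ ks) F n = cong (coeff (F k) n ℚ.+_) (coeff-∑ ks F n)

module _ where
  open SeriesRing
  open ≈-Reasoning setoid

  θ-cong : ∀ {f g} → f ≈ g → θ f ≈ θ g
  θ-cong f≈g = mk≗ λ n → cong (fromℕ n ℚ.*_) (at f≈g n)

  θ-+ : ∀ f g → θ (f + g) ≈ θ f + θ g
  θ-+ f g = mk≗ λ n → ℚ.*-distribˡ-+ (fromℕ n) (coeff f n) (coeff g n)

  θ-* : ∀ f g → θ (f * g) ≈ θ f * g + f * θ g
  θ-* f g = mk≗ λ n → trans (conv-θ (coeff f) (coeff g) n)
    (cong₂ ℚ._+_ (conv-cong (λ _ → refl) (λ _ → refl) n) (conv-cong (λ _ → refl) (λ _ → refl) n))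

  θ-const : ∀ c → θ (const c) ≈ 0#
  θ-const c = mk≗ λ { zero → ℚ.*-zeroˡ c ; (suc n) → ℚ.*-zeroʳ (fromℕ (suc n)) }

  θ-X : θ X ≈ X
  θ-X = mk≗ λ { zero → refl ; (suc zero) → refl ; (suc (suc n)) → ℚ.*-zeroʳ (fromℕ (2 ℕ.+ n)) }

  θ-∑ : ∀ ks (F : ℕ → Series) → θ (∑ ks F) ≈ ∑[ k ∈ ks ] θ (F k)
  θ-∑ []       F = θ-const ℚ.0ℚ
  θ-∑ (k ∷ ks) F = ≈-trans (θ-+ (F k) (∑ ks F)) (+-congˡ (θ-∑ ks F))

  σ-cong : ∀ c {f g} → f ≈ g → σ c f ≈ σ c g
  σ-cong c f≈g = mk≗ λ n → cong (c ^ n ℚ.*_) (at f≈g n)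

  σ-+ : ∀ c f g → σ c (f + g) ≈ σ c f + σ c g
  σ-+ c f g = mk≗ λ n → ℚ.*-distribˡ-+ (c ^ n) (coeff f n) (coeff g n)

  σ-neg : ∀ c f → σ c (- f) ≈ - σ c f
  σ-neg c f = mk≗ λ n → sym (ℚ.neg-distribʳ-* (c ^ n) (coeff f n))

  σ-* : ∀ c f g → σ c (f * g) ≈ σ c f * σ c g
  σ-* c f g = mk≗ λ n → trans (conv-σ c (coeff f) (coeff g) n)
    (conv-cong (λ _ → refl) (λ _ → refl) n)

  σ-const : ∀ c d → σ c (const d) ≈ const d
  σ-const c d = mk≗ λ { zero → ℚ.*-identityˡ d ; (suc n) → ℚ.*-zeroʳ (c ^ suc n) }

  σ-X : ∀ c → σ c X ≈ const c * X
  σ-X c = mk≗ λ n → trans (go n) (sym (const-*ₛ c X n))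
    where
    go : ∀ n → c ^ n ℚ.* coeff X n ≡ c ℚ.* coeff X n
    go zero          = trans (ℚ.*-zeroʳ 1ℚ) (sym (ℚ.*-zeroʳ c))
    go (suc zero)    = cong (ℚ._* 1ℚ) (ℚ.*-identityʳ c)
    go (suc (suc n)) = trans (ℚ.*-zeroʳ (c ^ (2 ℕ.+ n))) (sym (ℚ.*-zeroʳ c))

  θ-σ : ∀ c f → θ (σ c f) ≈ σ c (θ f)
  θ-σ c f = mk≗ λ n → ℚ.+-*-Solver.solve 3 (λ k p x → k ℚS.:* (p ℚS.:* x) ℚS.:= p ℚS.:* (k ℚS.:* x)) refl
    (fromℕ n) (c ^ n) (coeff f n)
    where module ℚS = ℚ.+-*-Solver

  coeff-cX* : ∀ c f n → coeff (const c * X * f) (suc n) ≡ c ℚ.* coeff f n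
  coeff-cX* c f n = trans (at (*-assoc (const c) X f) (suc n))
    (trans (const-*ₛ c (X * f) (suc n)) (cong (c ℚ.*_) (coeff-X* f n)))

  θ-exp : ∀ x → θ (exp x) ≈ const x * X * exp x
  θ-exp x = mk≗ λ { zero → sym (trans (cong (ℚ._* 1ℚ) (ℚ.*-zeroʳ x)) refl)
                  ; (suc n) → trans (step n) (sym (coeff-cX* x (exp x) n)) }
    where
    module ℚS = ℚ.+-*-Solver
    step : ∀ n → fromℕ (suc n) ℚ.* (x ℚ.* recip (suc n) ℚ.* expCoeff x n) ≡ x ℚ.* expCoeff x n
    step n = trans
      (ℚS.solve 4 (λ k x r e → k ℚS.:* (x ℚS.:* r ℚS.:* e) ℚS.:= (k ℚS.:* r) ℚS.:* (x ℚS.:* e)) refl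
        (fromℕ (suc n)) x (recip (suc n)) (expCoeff x n))
      (trans (cong (ℚ._* (x ℚ.* expCoeff x n)) (fromℕ-recip (suc n))) (ℚ.*-identityˡ _))

  -- The differential equation says (n + 1) fₙ₊₁ = x fₙ, so every coefficient follows from the
  -- previous one. The addition and scaling laws of the exponential are obtained from this without
  -- the binomial theorem.
  exp-unique : ∀ x f → coeff f 0 ≡ 1ℚ → θ f ≈ const x * X * f → f ≈ exp x
  exp-unique x f f0≡1 θf = mk≗ go
    where
    go : ∀ n → coeff f n ≡ expCoeff x n
    go zero    = f0≡1
    go (suc n) = fromℕ-cancel (suc n)
      (trans (at θf (suc n)) (trans (coeff-cX* x f n) (trans (cong (x ℚ.*_) (go n))
        (sym (trans (at (θ-exp x) (suc n)) (coeff-cX* x (exp x) n))))))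

  exp-+ : ∀ x y → exp x * exp y ≈ exp (x ℚ.+ y)
  exp-+ x y = exp-unique (x ℚ.+ y) (exp x * exp y) refl (begin
    θ (exp x * exp y)
      ≈⟨ θ-* (exp x) (exp y) ⟩
    θ (exp x) * exp y + exp x * θ (exp y)
      ≈⟨ +-cong (*-congʳ (θ-exp x)) (*-congˡ (θ-exp y)) ⟩
    const x * X * exp x * exp y + exp x * (const y * X * exp y)
      ≈⟨ solve 5 (λ x y t e f → x :* t :* e :* f :+ e :* (y :* t :* f) := (x :+ y) :* t :* (e :* f)) ≈-refl
           (const x) (const y) X (exp x) (exp y) ⟩
    (const x + const y) * X * (exp x * exp y)
      ≈⟨ *-congʳ (*-congʳ (mk≗ λ { zero → refl ; (suc n) → refl })) ⟩
    const (x ℚ.+ y) * X * (exp x * exp y) ∎)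

  exp-0 : exp ℚ.0ℚ ≈ 1#
  exp-0 = ≈-sym (exp-unique ℚ.0ℚ 1# refl (≈-trans (θ-const 1ℚ)
    (solve 1 (λ t → con ℚ.0ℚ := con ℚ.0ℚ :* t :* con 1ℚ) ≈-refl X)))

  σ-exp : ∀ c x → σ c (exp x) ≈ exp (c ℚ.* x)
  σ-exp c x = exp-unique (c ℚ.* x) (σ c (exp x)) refl (begin
    θ (σ c (exp x))                           ≈⟨ θ-σ c (exp x) ⟩
    σ c (θ (exp x))                           ≈⟨ σ-cong c (θ-exp x) ⟩
    σ c (const x * X * exp x)                 ≈⟨ ≈-trans (σ-* c (const x * X) (exp x)) (*-congʳ (σ-* c (const x) X)) ⟩
    σ c (const x) * σ c X * σ c (exp x)       ≈⟨ *-congʳ (*-cong (σ-const c x) (σ-X c)) ⟩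
    const x * (const c * X) * σ c (exp x)     ≈⟨ solve 4 (λ x c t e → x :* (c :* t) :* e := (c :* x) :* t :* e) ≈-refl (const x) (const c) X (σ c (exp x)) ⟩
    const c * const x * X * σ c (exp x)       ≈⟨ *-congʳ (*-congʳ (const-* c x)) ⟨
    const (c ℚ.* x) * X * σ c (exp x)         ∎)
    where
    const-* : ∀ p q → const (p ℚ.* q) ≈ const p * const q
    const-* = RingMorphisms.IsRingHomomorphism.*-homo ι-isRingHomomorphism

  -- The series h is t times a series with constant term 1, and both factors can be cancelled. This
  -- replaces division by eᵗ - 1, which has no inverse here.
  *-cancelʳ-order1 : ∀ {f g} h → coeff h 0 ≡ ℚ.0ℚ → coeff h 1 ≡ 1ℚ → f * h ≈ g * h → f ≈ g
  *-cancelʳ-order1 {f} {g} h h0≡0 h1≡1 fh≈gh = begin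
    f           ≈⟨ solve 2 (λ f g → f := (f :- g) :+ g) ≈-refl f g ⟩
    d + g       ≈⟨ +-congʳ d≈0 ⟩
    0# + g      ≈⟨ +-identityˡ g ⟩
    g           ∎
    where
    d = f - g

    hd≈0 : h * d ≈ 0#
    hd≈0 = begin
      h * (f - g)         ≈⟨ solve 3 (λ h f g → h :* (f :- g) := f :* h :- g :* h) ≈-refl h f g ⟩
      f * h - g * h       ≈⟨ +-congʳ fh≈gh ⟩
      g * h - g * h       ≈⟨ -‿inverseʳ (g * h) ⟩
      0#                  ∎

    -- Coefficient n + 1 of h d is coefficient n of (h/t) d, because the constant term of h
    -- vanishes.
    du≡0 : ∀ n → conv (coeff d) (coeff h ∘ suc) n ≡ ℚ.0ℚ
    du≡0 n = trans (conv-comm (coeff d) (coeff h ∘ suc) n)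
      (trans (sym (ℚ.+-identityˡ _))
        (trans (cong (ℚ._+ conv (coeff h ∘ suc) (coeff d) n)
                 (sym (trans (cong (ℚ._* coeff d (suc n)) h0≡0) (ℚ.*-zeroˡ (coeff d (suc n))))))
          (at hd≈0 (suc n))))

    d≈0 : d ≈ 0#
    d≈0 = mk≗ λ n → trans (conv-zero-divisor h1≡1 n (coeff d) du≡0) (sym (0-coeff n))

  -- Telescoping, written as a product so that no quotient of series is needed.
  geometric : ∀ m → (∑[ k ∈ upTo m ] exp (fromℕ k)) * (exp 1ℚ - 1#) ≈ exp (fromℕ m) - 1#
  geometric zero    = begin
    0# * (exp 1ℚ - 1#)       ≈⟨ zeroˡ _ ⟩
    0#                       ≈⟨ -‿inverseʳ 1# ⟨
    1# - 1#                  ≈⟨ +-congʳ exp-0 ⟨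
    exp ℚ.0ℚ - 1#            ∎
  geometric (suc m) = begin
    (∑[ k ∈ upTo (suc m) ] exp (fromℕ k)) * (exp 1ℚ - 1#)
      ≈⟨ *-congʳ (∑-upTo-∷ʳ m _) ⟩
    (∑G + exp (fromℕ m)) * (exp 1ℚ - 1#)
      ≈⟨ solve 3 (λ s e f → (s :+ f) :* (e :- con 1ℚ) := s :* (e :- con 1ℚ) :+ (e :* f :- f)) ≈-refl
           ∑G (exp 1ℚ) (exp (fromℕ m)) ⟩
    ∑G * (exp 1ℚ - 1#) + (exp 1ℚ * exp (fromℕ m) - exp (fromℕ m))
      ≈⟨ +-cong (geometric m) (+-congʳ (exp-+ 1ℚ (fromℕ m))) ⟩
    exp (fromℕ m) - 1# + (exp (1ℚ ℚ.+ fromℕ m) - exp (fromℕ m))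
      ≈⟨ solve 2 (λ f g → f :- con 1ℚ :+ (g :- f) := g :- con 1ℚ) ≈-refl (exp (fromℕ m)) (exp (1ℚ ℚ.+ fromℕ m)) ⟩
    exp (1ℚ ℚ.+ fromℕ m) - 1#
      ≡⟨ cong (λ x → exp x - 1#) (fromℕ-suc m) ⟨
    exp (fromℕ (suc m)) - 1# ∎
    where ∑G = ∑[ k ∈ upTo m ] exp (fromℕ k)

  -- Identities for β(t) = t/(eᵗ - 1)

  module BernoulliSeries (β : Series) (β-def : β * (exp 1ℚ - 1#) ≈ X) where
    private
      D = exp 1ℚ - 1#

      -- All that is known of β is its product with D. Hence `raabe`, `reflection` and `θ-β` are
      -- verified after multiplication by D.
      cancelD : ∀ {f g} → f * D ≈ g * D → f ≈ g
      cancelD = *-cancelʳ-order1 D refl refl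

      σβ : ∀ c → σ c β * (exp c - 1#) ≈ const c * X
      σβ c = begin
        σ c β * (exp c - 1#)                  ≡⟨ cong (λ x → σ c β * (exp x - 1#)) (ℚ.*-identityʳ c) ⟨
        σ c β * (exp (c ℚ.* 1ℚ) - 1#)         ≈⟨ *-congˡ (+-cong (σ-exp c 1ℚ) (≈-trans (σ-neg c 1#) (-‿cong (σ-const c 1ℚ)))) ⟨
        σ c β * (σ c (exp 1ℚ) + σ c (- 1#))   ≈⟨ *-congˡ (σ-+ c (exp 1ℚ) (- 1#)) ⟨
        σ c β * σ c D                         ≈⟨ σ-* c β D ⟨
        σ c (β * D)                           ≈⟨ σ-cong c β-def ⟩
        σ c X                                 ≈⟨ σ-X c ⟩
        const c * X                           ∎

    -- Raabe's formula at the level of generating functions: both sides times eᵗ - 1 equal m t.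
    raabe : ∀ m → σ (fromℕ m) β * (∑[ k ∈ upTo m ] exp (fromℕ k)) ≈ const (fromℕ m) * β
    raabe m = cancelD (begin
      σ (fromℕ m) β * (∑[ k ∈ upTo m ] exp (fromℕ k)) * D   ≈⟨ *-assoc _ _ _ ⟩
      σ (fromℕ m) β * ((∑[ k ∈ upTo m ] exp (fromℕ k)) * D) ≈⟨ *-congˡ (geometric m) ⟩
      σ (fromℕ m) β * (exp (fromℕ m) - 1#)                  ≈⟨ σβ (fromℕ m) ⟩
      const (fromℕ m) * X                                   ≈⟨ *-congˡ β-def ⟨
      const (fromℕ m) * (β * D)                             ≈⟨ *-assoc _ _ _ ⟨
      const (fromℕ m) * β * D                               ∎)

    -- Multiplying β(-t) (e⁻ᵗ - 1) = -t by -eᵗ gives β(-t) (eᵗ - 1) = t eᵗ = t + t (eᵗ - 1), and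
    -- this t is β(t) (eᵗ - 1).
    reflection : σ (ℚ.- 1ℚ) β ≈ β + X
    reflection = cancelD (begin
      σβ- * D
        ≈⟨ solve 2 (λ s e → s :* (e :- con 1ℚ) := s :* (e :* con 1ℚ :- con 1ℚ)) ≈-refl σβ- e ⟩
      σβ- * (e * 1# - 1#)
        ≈⟨ *-congˡ (+-congˡ (-‿cong ee′≈1)) ⟨
      σβ- * (e * 1# - e * e′)
        ≈⟨ solve 3 (λ s e e′ → s :* (e :* con 1ℚ :- e :* e′) := :- e :* (s :* (e′ :- con 1ℚ))) ≈-refl σβ- e e′ ⟩
      - e * (σβ- * (e′ - 1#))
        ≈⟨ *-congˡ (σβ (ℚ.- 1ℚ)) ⟩
      - e * (const (ℚ.- 1ℚ) * X)
        ≈⟨ solve 2 (λ e t → :- e :* (con (ℚ.- 1ℚ) :* t) := t :+ t :* (e :- con 1ℚ)) ≈-refl e X ⟩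
      X + X * D
        ≈⟨ +-congʳ β-def ⟨
      β * D + X * D
        ≈⟨ distribʳ D β X ⟨
      (β + X) * D ∎)
      where
      σβ- = σ (ℚ.- 1ℚ) β
      e  = exp 1ℚ
      e′ = exp (ℚ.- 1ℚ)

      ee′≈1 : e * e′ ≈ 1#
      ee′≈1 = ≈-trans (exp-+ 1ℚ (ℚ.- 1ℚ)) exp-0

    -- Differentiating β D = t gives θβ D + β t eᵗ = t, where eᵗ = D + 1.
    θ-β : θ β ≈ β - X * β - β * β
    θ-β = cancelD (begin
      θ β * D
        ≈⟨ solve 3 (λ b′ d c → b′ :* d := (b′ :* d :+ c) :- c) ≈-refl (θ β) D (β * θ D) ⟩
      (θ β * D + β * θ D) - β * θ D
        ≈⟨ +-cong (≈-trans (≈-sym (θ-* β D)) (≈-trans (θ-cong β-def) θ-X)) (-‿cong (*-congˡ θD)) ⟩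
      X - β * (X * (D + 1#))
        ≈⟨ solve 3 (λ t b d → t :- b :* (t :* (d :+ con 1ℚ)) := t :- t :* (b :* d) :- b :* t) ≈-refl X β D ⟩
      X - X * (β * D) - β * X
        -- Replacing these two occurrences of t by β D makes D a factor of every term.
        ≈⟨ +-cong (+-congʳ (≈-sym β-def)) (-‿cong (*-congˡ (≈-sym β-def))) ⟩
      β * D - X * (β * D) - β * (β * D)
        ≈⟨ solve 3 (λ t b d → b :* d :- t :* (b :* d) :- b :* (b :* d) := (b :- t :* b :- b :* b) :* d) ≈-refl X β D ⟩
      (β - X * β - β * β) * D ∎)
      where
      θD : θ D ≈ X * (D + 1#)
      θD = begin
        θ D                       ≈⟨ θ-+ (exp 1ℚ) (- 1#) ⟩
        θ (exp 1ℚ) + θ (- 1#)     ≈⟨ +-cong (θ-exp 1ℚ) (mk≗ λ { zero → refl ; (suc n) → ℚ.*-zeroʳ (fromℕ (suc n)) }) ⟩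
        1# * X * exp 1ℚ + 0#      ≈⟨ solve 2 (λ t e → con 1ℚ :* t :* e :+ con ℚ.0ℚ := t :* (e :- con 1ℚ :+ con 1ℚ)) ≈-refl X (exp 1ℚ) ⟩
        X * (D + 1#)              ∎

    -- Write G = Σ eᵏᵗ and H = Σ k eᵏᵗ. Since t H = θG, the product rule applied to β(Nt) G = N β
    -- expresses t β(Nt) H by θβ and by the derivative of β(Nt). The formula for θβ, also taken at
    -- Nt, removes both derivatives, and `raabe` removes G. The factor t is there because H occurs
    -- only as t H.
    weighted-sum : ∀ N .{{_ : NonZero N}} →
      X * (σ (fromℕ N) β * (∑[ k ∈ upTo N ] const (+ k / N) * exp (fromℕ k)))
      ≈ const (fromℕ N) * (X * β) + β * σ (fromℕ N) β - X * β - β * β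
    weighted-sum N = begin
      X * (σNβ * (∑[ k ∈ upTo N ] const (+ k / N) * exp (fromℕ k)))
        ≈⟨ *-congˡ (*-congˡ (≈-trans (∑-cong (upTo N) (λ k → ≈-trans (*-congʳ (weight k)) (*-assoc r _ _))) (≈-sym (*-∑ r (upTo N) _)))) ⟩
      X * (σNβ * (r * H))
        -- Adding and subtracting θ(β(Nt)) G completes t β(Nt) H to the derivative of β(Nt) G.
        ≈⟨ solve 5 (λ t s r h c → t :* (s :* (r :* h)) := r :* ((c :+ s :* (t :* h)) :- c)) ≈-refl X σNβ r H (θ σNβ * G) ⟩
      r * ((θ σNβ * G + σNβ * (X * H)) - θ σNβ * G)
        ≈⟨ *-congˡ (+-cong derivative (-‿cong (≈-trans (*-congʳ θσ)
             (solve 5 (λ s n t b g → (s :- n :* t :* s :- s :* s) :* g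
                                     := (s :* g) :- n :* t :* (s :* g) :- s :* (s :* g)) ≈-refl σNβ n X β G)))) ⟩
      r * (n * (β - X * β - β * β) - ((σNβ * G) - n * X * (σNβ * G) - σNβ * (σNβ * G)))
        ≈⟨ *-congˡ (+-congˡ (-‿cong (+-cong (+-cong (raabe N) (-‿cong (*-congˡ (raabe N)))) (-‿cong (*-congˡ (raabe N)))))) ⟩
      r * (n * (β - X * β - β * β) - (n * β - n * X * (n * β) - σNβ * (n * β)))
        ≈⟨ solve 5 (λ r n b t s → r :* (n :* (b :- t :* b :- b :* b) :- (n :* b :- n :* t :* (n :* b) :- s :* (n :* b)))
                                  := (n :* r) :* (n :* (t :* b) :+ b :* s :- t :* b :- b :* b)) ≈-refl r n β X σNβ ⟩
      n * r * (n * (X * β) + β * σNβ - X * β - β * β)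
        ≈⟨ ≈-trans (*-congʳ nr≈1) (*-identityˡ _) ⟩
      n * (X * β) + β * σNβ - X * β - β * β ∎
      where
      n   = const (fromℕ N)
      r   = const (recip N)
      σNβ = σ (fromℕ N) β
      G   = ∑[ k ∈ upTo N ] exp (fromℕ k)
      H   = ∑[ k ∈ upTo N ] const (fromℕ k) * exp (fromℕ k)

      ι-* : ∀ p q → const (p ℚ.* q) ≈ const p * const q
      ι-* = RingMorphisms.IsRingHomomorphism.*-homo ι-isRingHomomorphism

      nr≈1 : n * r ≈ 1#
      nr≈1 = ≈-trans (≈-sym (ι-* (fromℕ N) (recip N))) (reflexive (cong const (fromℕ-recip N)))

      weight : ∀ k → const (+ k / N) ≈ r * const (fromℕ k)
      weight k = ≈-trans (reflexive (cong const (/-split k N))) (≈-trans (ι-* (fromℕ k) (recip N)) (*-comm _ _))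

      θG : θ G ≈ X * H
      θG = begin
        θ G                                                     ≈⟨ θ-∑ (upTo N) _ ⟩
        (∑[ k ∈ upTo N ] θ (exp (fromℕ k)))                     ≈⟨ ∑-cong (upTo N) (λ k → ≈-trans (θ-exp (fromℕ k))
                                                                     (solve 3 (λ k t e → k :* t :* e := t :* (k :* e)) ≈-refl (const (fromℕ k)) X (exp (fromℕ k)))) ⟩
        (∑[ k ∈ upTo N ] X * (const (fromℕ k) * exp (fromℕ k))) ≈⟨ *-∑ X (upTo N) _ ⟨
        X * H                                                   ∎

      derivative : θ σNβ * G + σNβ * (X * H) ≈ n * (β - X * β - β * β)
      derivative = begin
        θ σNβ * G + σNβ * (X * H)     ≈⟨ +-congˡ (*-congˡ θG) ⟨
        θ σNβ * G + σNβ * θ G         ≈⟨ θ-* σNβ G ⟨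
        θ (σNβ * G)                   ≈⟨ θ-cong (raabe N) ⟩
        θ (n * β)                     ≈⟨ θ-* n β ⟩
        θ n * β + n * θ β             ≈⟨ +-cong (*-congʳ (θ-const (fromℕ N))) (*-congˡ θ-β) ⟩
        0# * β + n * (β - X * β - β * β) ≈⟨ ≈-trans (+-congʳ (zeroˡ β)) (+-identityˡ _) ⟩
        n * (β - X * β - β * β)       ∎

      θσ : θ σNβ ≈ σNβ - n * X * σNβ - σNβ * σNβ
      θσ = begin
        θ σNβ                                                     ≈⟨ θ-σ c β ⟩
        σ c (θ β)                                                 ≈⟨ σ-cong c θ-β ⟩
        σ c (β - X * β - β * β)                                   ≈⟨ ≈-trans (σ-+ c _ _) (+-congʳ (σ-+ c _ _)) ⟩
        σ c β + σ c (- (X * β)) + σ c (- (β * β))                 ≈⟨ +-cong (+-congˡ (σ-neg c _)) (σ-neg c _) ⟩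
        σ c β - σ c (X * β) - σ c (β * β)                         ≈⟨ +-cong (+-congˡ (-‿cong (≈-trans (σ-* c X β) (*-congʳ (σ-X c))))) (-‿cong (σ-* c β β)) ⟩
        σNβ - n * X * σNβ - σNβ * σNβ                             ∎
        where c = fromℕ N

-- Bernoulli numbers and polynomials

fromℕ-^ : ∀ m n → fromℕ (m ℕ.^ n) ≡ fromℕ m ^ n
fromℕ-^ m zero    = refl
fromℕ-^ m (suc n) = trans (fromℕ-* m (m ℕ.^ n)) (cong (fromℕ m ℚ.*_) (fromℕ-^ m n))

-- The number 1/n!, defined as a coefficient of eᵗ so that products with `exp 1ℚ` contain it
-- literally.
invFact : ℕ → ℚ
invFact = expCoeff 1ℚ

module _ where
  open ≡-Reasoning
  open FiniteSum ℚ.+-0-rawMonoid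
  open ℚSums
  open ℚ.+-*-Solver

  invFact-suc : ∀ n → fromℕ (suc n) ℚ.* invFact (suc n) ≡ invFact n
  invFact-suc n = begin
    fromℕ (suc n) ℚ.* (1ℚ ℚ.* recip (suc n) ℚ.* invFact n)
      ≡⟨ solve 3 (λ k r e → k :* (con 1ℚ :* r :* e) := (k :* r) :* e) refl (fromℕ (suc n)) (recip (suc n)) (invFact n) ⟩
    fromℕ (suc n) ℚ.* recip (suc n) ℚ.* invFact n  ≡⟨ cong (ℚ._* invFact n) (fromℕ-recip (suc n)) ⟩
    1ℚ ℚ.* invFact n                               ≡⟨ ℚ.*-identityˡ _ ⟩
    invFact n                                      ∎

  fact-invFact : ∀ n → fromℕ (n !) ℚ.* invFact n ≡ 1ℚ
  fact-invFact zero    = refl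
  fact-invFact (suc n) = begin
    fromℕ (suc n ℕ.* n !) ℚ.* invFact (suc n)            ≡⟨ cong (ℚ._* invFact (suc n)) (fromℕ-* (suc n) (n !)) ⟩
    fromℕ (suc n) ℚ.* fromℕ (n !) ℚ.* invFact (suc n)    ≡⟨ solve 3 (λ k f e → k :* f :* e := f :* (k :* e)) refl (fromℕ (suc n)) (fromℕ (n !)) (invFact (suc n)) ⟩
    fromℕ (n !) ℚ.* (fromℕ (suc n) ℚ.* invFact (suc n))  ≡⟨ cong (fromℕ (n !) ℚ.*_) (invFact-suc n) ⟩
    fromℕ (n !) ℚ.* invFact n                            ≡⟨ fact-invFact n ⟩
    1ℚ                                                   ∎

  expCoeff-^ : ∀ x n → expCoeff x n ≡ x ^ n ℚ.* invFact n
  expCoeff-^ x zero    = refl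
  expCoeff-^ x (suc n) = trans (cong (x ℚ.* recip (suc n) ℚ.*_) (expCoeff-^ x n))
    (solve 4 (λ x r p e → x :* r :* (p :* e) := (x :* p) :* (con 1ℚ :* r :* e)) refl
      x (recip (suc n)) (x ^ n) (invFact n))

  recip-! : ∀ n .{{_ : NonZero (n !)}} → recip (n !) ≡ invFact n
  recip-! n = fromℕ-cancel (n !) (trans (fromℕ-recip (n !)) (sym (fact-invFact n)))

  binomial-invFact : ∀ {n i} → i ≤ n →
    fromℕ (n C i) ≡ fromℕ (n !) ℚ.* (invFact i ℚ.* invFact (n ℕ.∸ i))
  binomial-invFact {n} {i} i≤n = begin
    c                                    ≡⟨ solve 1 (λ c → c := c :* (con 1ℚ :* con 1ℚ)) refl c ⟩
    c ℚ.* (1ℚ ℚ.* 1ℚ)                    ≡⟨ cong (c ℚ.*_) (cong₂ ℚ._*_ (fact-invFact i) (fact-invFact j)) ⟨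
    c ℚ.* (fi ℚ.* invFact i ℚ.* (fj ℚ.* invFact j))
      ≡⟨ solve 5 (λ c fi ei fj ej → c :* (fi :* ei :* (fj :* ej)) := c :* (fi :* fj) :* (ei :* ej)) refl
           c fi (invFact i) fj (invFact j) ⟩
    c ℚ.* (fi ℚ.* fj) ℚ.* (invFact i ℚ.* invFact j)
      ≡⟨ cong (ℚ._* (invFact i ℚ.* invFact j)) (begin
           c ℚ.* (fi ℚ.* fj)                     ≡⟨ cong (c ℚ.*_) (fromℕ-* (i !) (j !)) ⟨
           c ℚ.* fromℕ (i ! ℕ.* j !)             ≡⟨ fromℕ-* (n C i) (i ! ℕ.* j !) ⟨
           fromℕ ((n C i) ℕ.* (i ! ℕ.* j !))     ≡⟨ cong fromℕ (trans (cong (ℕ._* (i ! ℕ.* j !)) (nCk≡n!/k![n-k]! i≤n))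
                                                      (m/n*n≡m {{i !* j !≢0}} (k![n∸k]!∣n! i≤n))) ⟩
           fromℕ (n !)                           ∎) ⟩
    fromℕ (n !) ℚ.* (invFact i ℚ.* invFact j) ∎
    where
    j  = n ℕ.∸ i
    c  = fromℕ (n C i)
    fi = fromℕ (i !)
    fj = fromℕ (j !)

  -- Products of exponential generating functions are binomial convolutions. This is the dictionary
  -- between series and the sums that define Bernoulli numbers and polynomials.
  binomial-conv : ∀ (f g : ℕ → ℚ) n →
    fromℕ (n !) ℚ.* conv (λ i → f i ℚ.* invFact i) (λ j → g j ℚ.* invFact j) n
    ≡ ∑[ i ∈ upTo (suc n) ] fromℕ (n C i) ℚ.* f i ℚ.* g (n ℕ.∸ i)
  binomial-conv f g n = begin
    fromℕ (n !) ℚ.* conv (λ i → f i ℚ.* invFact i) (λ j → g j ℚ.* invFact j) n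
      ≡⟨ cong (fromℕ (n !) ℚ.*_) (conv-explicit (λ i → f i ℚ.* invFact i) (λ j → g j ℚ.* invFact j) n) ⟩
    fromℕ (n !) ℚ.* (∑[ i ∈ upTo (suc n) ] (f i ℚ.* invFact i) ℚ.* (g (n ℕ.∸ i) ℚ.* invFact (n ℕ.∸ i)))
      ≡⟨ *-∑ (fromℕ (n !)) (upTo (suc n)) _ ⟩
    (∑[ i ∈ upTo (suc n) ] fromℕ (n !) ℚ.* ((f i ℚ.* invFact i) ℚ.* (g (n ℕ.∸ i) ℚ.* invFact (n ℕ.∸ i))))
      ≡⟨ ∑-cong-< (suc n) (λ i i≤n → trans
           (solve 5 (λ k x e y d → k :* ((x :* e) :* (y :* d)) := k :* (e :* d) :* x :* y) refl
             (fromℕ (n !)) (f i) (invFact i) (g (n ℕ.∸ i)) (invFact (n ℕ.∸ i)))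
           (cong (λ c → c ℚ.* f i ℚ.* g (n ℕ.∸ i)) (sym (binomial-invFact (ℕ.≤-pred i≤n))))) ⟩
    (∑[ i ∈ upTo (suc n) ] fromℕ (n C i) ℚ.* f i ℚ.* g (n ℕ.∸ i)) ∎

lookup-∷ʳ-fromℕ : ∀ {n} (xs : Vec ℚ n) x → lookup (xs ∷ʳ x) (Fin.fromℕ n) ≡ x
lookup-∷ʳ-fromℕ []       x = refl
lookup-∷ʳ-fromℕ (y ∷ xs) x = lookup-∷ʳ-fromℕ xs x

lookup-∷ʳ-inject₁ : ∀ {n} (xs : Vec ℚ n) x i → lookup (xs ∷ʳ x) (Fin.inject₁ i) ≡ lookup xs i
lookup-∷ʳ-inject₁ (y ∷ xs) x Fin.zero    = refl
lookup-∷ʳ-inject₁ (y ∷ xs) x (Fin.suc i) = lookup-∷ʳ-inject₁ xs x i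

bernoulli-next : ∀ n → bernoulli n ≡ nextBernoulli n (bernoullis n)
bernoulli-next n = last-∷ʳ (nextBernoulli n (bernoullis n)) (bernoullis n)

-- The vectors grow only at the end, so entry i keeps the value it received at stage i.
lookup-bernoullis : ∀ n (i : Fin n) → lookup (bernoullis n) i ≡ bernoulli (Fin.toℕ i)
lookup-bernoullis (suc n) i with Top.view i
... | Top.‵fromℕ     = trans (lookup-∷ʳ-fromℕ (bernoullis n) _)
  (trans (sym (bernoulli-next n)) (cong bernoulli (sym (Fin.toℕ-fromℕ n))))
... | Top.‵inject₁ j = trans (lookup-∷ʳ-inject₁ (bernoullis n) _ j)
  (trans (lookup-bernoullis n j) (cong bernoulli (sym (Fin.toℕ-inject₁ j))))

-- With n = k + 1 the definition of Bₙ is in its recursive case. The last term has coefficient (n +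
-- 1 choose n) = n + 1, which cancels the factor 1/(n + 1) in Bₙ and leaves minus the sum of the
-- other terms.
bernoulli-recurrence : ∀ k → FiniteSum.∑ ℚ.+-0-rawMonoid (upTo (2 ℕ.+ k))
  (λ i → fromℕ ((2 ℕ.+ k) C i) ℚ.* bernoulli i) ≡ ℚ.0ℚ
bernoulli-recurrence k = begin
  ∑ (upTo (suc n)) c                             ≡⟨ ∑-upTo-∷ʳ n c ⟩
  ∑ (upTo n) c ℚ.+ fromℕ (suc n C n) ℚ.* bernoulli n
    ≡⟨ cong₂ (λ m x → ∑ (upTo n) c ℚ.+ fromℕ m ℚ.* x)
         (trans (nCk≡nC[n∸k] (ℕ.n≤1+n n)) (trans (cong (suc n C_) (ℕ.m+n∸n≡m 1 n)) (nC1≡n (suc n))))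
         (trans (bernoulli-next n) (cong (λ s → ℚ.- (recip (suc n) ℚ.* s)) (∑-Fin n c (λ i → fromℕ (suc n C Fin.toℕ i) ℚ.* lookup (bernoullis n) i)
           (λ i → cong (fromℕ (suc n C Fin.toℕ i) ℚ.*_) (lookup-bernoullis n i))))) ⟩
  ∑ (upTo n) c ℚ.+ fromℕ (suc n) ℚ.* (ℚ.- (recip (suc n) ℚ.* ∑ (upTo n) c))
    ≡⟨ solve 3 (λ s m r → s :+ m :* (:- (r :* s)) := s :- (m :* r) :* s) refl (∑ (upTo n) c) (fromℕ (suc n)) (recip (suc n)) ⟩
  ∑ (upTo n) c ℚ.- fromℕ (suc n) ℚ.* recip (suc n) ℚ.* ∑ (upTo n) c
    ≡⟨ cong (λ x → ∑ (upTo n) c ℚ.- x ℚ.* ∑ (upTo n) c) (fromℕ-recip (suc n)) ⟩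
  ∑ (upTo n) c ℚ.- 1ℚ ℚ.* ∑ (upTo n) c
    ≡⟨ solve 1 (λ s → s :- con 1ℚ :* s := con ℚ.0ℚ) refl (∑ (upTo n) c) ⟩
  ℚ.0ℚ ∎
  where
  open ≡-Reasoning
  open FiniteSum ℚ.+-0-rawMonoid
  open ℚSums
  open ℚ.+-*-Solver
  open RawMonoidDefs ℚ.+-0-rawMonoid using (sum)
  n = suc k

  c : ℕ → ℚ
  c i = fromℕ (suc n C i) ℚ.* bernoulli i

  ∑-Fin : ∀ n (g : ℕ → ℚ) (h : Fin n → ℚ) → (∀ i → h i ≡ g (Fin.toℕ i)) → sum h ≡ ∑ (upTo n) g
  ∑-Fin zero    g h h≡g = refl
  ∑-Fin (suc n) g h h≡g = trans (cong₂ ℚ._+_ (h≡g Fin.zero) (∑-Fin n (g ∘ suc) (h ∘ Fin.suc) (h≡g ∘ Fin.suc)))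
    (sym (∑-upTo-suc n g))

β : Series
coeff β n = bernoulli n ℚ.* invFact n

-- After multiplication by n!, the left coefficient is the sum of (n choose i) Bᵢ for i ≤ n. For n ≥
-- 2 the recurrence removes all terms but Bₙ.
β*exp1 : β *ₛ exp 1ℚ ≗ₛ β +ₛ X
β*exp1 = mk≗ λ n → fromℕ-cancel (n !) {{n !≢0}} (trans (explicit n) (go n))
  where
  open ≡-Reasoning
  open FiniteSum ℚ.+-0-rawMonoid
  open ℚSums

  explicit : ∀ n → fromℕ (n !) ℚ.* coeff (β *ₛ exp 1ℚ) n
                   ≡ ∑[ i ∈ upTo (suc n) ] fromℕ (n C i) ℚ.* bernoulli i
  explicit n = begin
    fromℕ (n !) ℚ.* conv (coeff β) (expCoeff 1ℚ) n
      ≡⟨ cong (fromℕ (n !) ℚ.*_) (conv-cong {coeff β} {coeff β} {expCoeff 1ℚ} {λ j → 1ℚ ℚ.* invFact j}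
           (λ _ → refl) (λ j → sym (ℚ.*-identityˡ _)) n) ⟩
    fromℕ (n !) ℚ.* conv (coeff β) (λ j → 1ℚ ℚ.* invFact j) n
      ≡⟨ binomial-conv bernoulli (λ _ → 1ℚ) n ⟩
    (∑[ i ∈ upTo (suc n) ] fromℕ (n C i) ℚ.* bernoulli i ℚ.* 1ℚ)
      ≡⟨ ∑-cong (upTo (suc n)) {g = λ i → fromℕ (n C i) ℚ.* bernoulli i} (λ i → ℚ.*-identityʳ _) ⟩
    (∑[ i ∈ upTo (suc n) ] fromℕ (n C i) ℚ.* bernoulli i) ∎

  go : ∀ n → ∑ (upTo (suc n)) (λ i → fromℕ (n C i) ℚ.* bernoulli i) ≡ fromℕ (n !) ℚ.* coeff (β +ₛ X) n
  go zero          = refl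
  -- The case where X contributes: B₀ + B₁ = B₁ + 1.
  go (suc zero)    = refl
  go n@(suc (suc k)) = begin
    ∑ (upTo (suc n)) (λ i → fromℕ (n C i) ℚ.* bernoulli i)
      ≡⟨ ∑-upTo-∷ʳ n (λ i → fromℕ (n C i) ℚ.* bernoulli i) ⟩
    ∑ (upTo n) (λ i → fromℕ (n C i) ℚ.* bernoulli i) ℚ.+ fromℕ (n C n) ℚ.* bernoulli n
      ≡⟨ cong₂ (λ s m → s ℚ.+ fromℕ m ℚ.* bernoulli n) (bernoulli-recurrence k) (nCn≡1 n) ⟩
    ℚ.0ℚ ℚ.+ 1ℚ ℚ.* bernoulli n
      ≡⟨ cong (λ x → ℚ.0ℚ ℚ.+ x ℚ.* bernoulli n) (fact-invFact n) ⟨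
    ℚ.0ℚ ℚ.+ fromℕ (n !) ℚ.* invFact n ℚ.* bernoulli n
      ≡⟨ solve 3 (λ f e x → con ℚ.0ℚ :+ f :* e :* x := f :* (x :* e :+ con ℚ.0ℚ)) refl (fromℕ (n !)) (invFact n) (bernoulli n) ⟩
    fromℕ (n !) ℚ.* (bernoulli n ℚ.* invFact n ℚ.+ ℚ.0ℚ) ∎
    where open ℚ.+-*-Solver

module _ where
  open SeriesRing

  β-def : β * (exp 1ℚ - 1#) ≈ X
  β-def = begin
    β * (exp 1ℚ - 1#)   ≈⟨ solve 2 (λ b e → b :* (e :- con 1ℚ) := b :* e :- b) ≈-refl β (exp 1ℚ) ⟩
    β * exp 1ℚ - β      ≈⟨ +-congʳ β*exp1 ⟩
    β + X - β           ≈⟨ solve 2 (λ b t → b :+ t :- b := t) ≈-refl β X ⟩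
    X                   ∎
    where open ≈-Reasoning setoid

open BernoulliSeries β β-def

-- The generating function t eˣᵗ/(eᵗ - 1) of the Bernoulli polynomials.
bernoulliPoly-coeff : ∀ n x → bernoulliPoly n x ≡ fromℕ (n !) ℚ.* coeff (β *ₛ exp x) n
bernoulliPoly-coeff n x = sym (trans
  (cong (fromℕ (n !) ℚ.*_) (conv-cong {coeff β} {coeff β} {expCoeff x} {λ j → x ^ j ℚ.* invFact j}
    (λ _ → refl) (expCoeff-^ x) n))
  (binomial-conv bernoulli (x ^_) n))

-- At an odd index the reflection formula equates -Bₙ/n! with Bₙ/n! plus a coefficient of X. Writing
-- the index as 3 + 2q lets that coefficient compute to 0.
bernoulli-odd : ∀ q → bernoulli (3 ℕ.+ q ℕ.* 2) ≡ ℚ.0ℚ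
bernoulli-odd q = begin
  B                                     ≡⟨ ℚ.*-identityˡ B ⟨
  1ℚ ℚ.* B                              ≡⟨ cong (ℚ._* B) (fact-invFact n) ⟨
  -- Here x = ½ (x - (-x)), and -x can be read as a coefficient of β(-t).
  f ℚ.* e ℚ.* B                         ≡⟨ solve 3 (λ f e x → f :* e :* x := f :* (con ℚ.½ :* (x :* e :- con (ℚ.- 1ℚ) :* (x :* e)))) refl f e B ⟩
  f ℚ.* (ℚ.½ ℚ.* (B ℚ.* e ℚ.- (ℚ.- 1ℚ) ℚ.* (B ℚ.* e)))
    ≡⟨ cong (λ x → f ℚ.* (ℚ.½ ℚ.* (B ℚ.* e ℚ.- x))) (trans (cong (ℚ._* (B ℚ.* e)) (sym (parity q))) (at reflection n)) ⟩
  f ℚ.* (ℚ.½ ℚ.* (B ℚ.* e ℚ.- (B ℚ.* e ℚ.+ ℚ.0ℚ)))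
    ≡⟨ solve 2 (λ f y → f :* (con ℚ.½ :* (y :- (y :+ con ℚ.0ℚ))) := con ℚ.0ℚ) refl f (B ℚ.* e) ⟩
  ℚ.0ℚ ∎
  where
  open ≡-Reasoning
  open ℚ.+-*-Solver
  n = 3 ℕ.+ q ℕ.* 2
  B = bernoulli n
  e = invFact n
  f = fromℕ (n !)

  parity : ∀ q → (ℚ.- 1ℚ) ^ (3 ℕ.+ q ℕ.* 2) ≡ ℚ.- 1ℚ
  parity zero    = refl
  parity (suc q) = trans
    (solve 1 (λ p → con (ℚ.- 1ℚ) :* (con (ℚ.- 1ℚ) :* p) := p) refl ((ℚ.- 1ℚ) ^ (3 ℕ.+ q ℕ.* 2)))
    (parity q)

-- The factor mⁿ clears the power m¹⁻ⁿ of the usual formula, and on series it is the substitution of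
-- mt for t. This turns the exponential with x + j/m into that with mx times eʲᵗ, and `raabe` sums
-- over j.
bernoulliPoly-multiplication : ∀ m .{{_ : NonZero m}} n x →
  fromℕ m ^ n ℚ.* FiniteSum.∑ ℚ.+-0-rawMonoid (upTo m) (λ j → bernoulliPoly n (x ℚ.+ (+ j / m)))
  ≡ fromℕ m ℚ.* bernoulliPoly n (fromℕ m ℚ.* x)
bernoulliPoly-multiplication m n x = begin
  M ^ n ℚ.* (∑[ j ∈ upTo m ] bernoulliPoly n (x ℚ.+ (+ j / m)))
    ≡⟨ cong (M ^ n ℚ.*_) (trans (∑-cong (upTo m) (λ j → bernoulliPoly-coeff n (x ℚ.+ (+ j / m))))
         (sym (*-∑ (fromℕ (n !)) (upTo m) _))) ⟩
  M ^ n ℚ.* (fromℕ (n !) ℚ.* (∑[ j ∈ upTo m ] coeff (β *ₛ exp (x ℚ.+ (+ j / m))) n))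
    ≡⟨ solve 3 (λ p f s → p :* (f :* s) := f :* (p :* s)) refl (M ^ n) (fromℕ (n !)) _ ⟩
  fromℕ (n !) ℚ.* (M ^ n ℚ.* (∑[ j ∈ upTo m ] coeff (β *ₛ exp (x ℚ.+ (+ j / m))) n))
    ≡⟨ cong (fromℕ (n !) ℚ.*_) (begin
         M ^ n ℚ.* (∑[ j ∈ upTo m ] coeff (β *ₛ exp (x ℚ.+ (+ j / m))) n)
           ≡⟨ *-∑ (M ^ n) (upTo m) _ ⟩
         (∑[ j ∈ upTo m ] coeff (σ M (β *ₛ exp (x ℚ.+ (+ j / m)))) n)
           ≡⟨ coeff-∑ (upTo m) _ n ⟨
         coeff (SeriesRing.∑ (upTo m) (λ j → σ M (β *ₛ exp (x ℚ.+ (+ j / m))))) n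
           ≡⟨ at scaled n ⟩
         coeff (const M *ₛ (β *ₛ exp (M ℚ.* x))) n
           ≡⟨ const-*ₛ M (β *ₛ exp (M ℚ.* x)) n ⟩
         M ℚ.* coeff (β *ₛ exp (M ℚ.* x)) n ∎) ⟩
  fromℕ (n !) ℚ.* (M ℚ.* coeff (β *ₛ exp (M ℚ.* x)) n)
    ≡⟨ solve 3 (λ f p s → f :* (p :* s) := p :* (f :* s)) refl (fromℕ (n !)) M _ ⟩
  M ℚ.* (fromℕ (n !) ℚ.* coeff (β *ₛ exp (M ℚ.* x)) n)
    ≡⟨ cong (M ℚ.*_) (bernoulliPoly-coeff n (M ℚ.* x)) ⟨
  M ℚ.* bernoulliPoly n (M ℚ.* x) ∎
  where
  open ≡-Reasoning
  open FiniteSum ℚ.+-0-rawMonoid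
  open ℚSums
  open ℚ.+-*-Solver
  M = fromℕ m

  argument : ∀ j → M ℚ.* (x ℚ.+ (+ j / m)) ≡ M ℚ.* x ℚ.+ fromℕ j
  argument j = trans (ℚ.*-distribˡ-+ M x (+ j / m)) (cong (M ℚ.* x ℚ.+_) (fromℕ-*-/ j m))

  scaled : SeriesRing.∑ (upTo m) (λ j → σ M (β *ₛ exp (x ℚ.+ (+ j / m)))) ≗ₛ const M *ₛ (β *ₛ exp (M ℚ.* x))
  scaled = S.≈-trans
    (S.∑-cong (upTo m) λ j → S.≈-trans (σ-* M β _) (S.≈-trans
      (S.*-congˡ (S.≈-trans (σ-exp M _) (S.≈-trans (S.reflexive (cong exp (argument j)))
        (S.≈-sym (exp-+ (M ℚ.* x) (fromℕ j))))))
      (S.solve 3 (λ s e f → s S.:* (e S.:* f) S.:= e S.:* s S.:* f) S.≈-refl (σ M β) (exp (M ℚ.* x)) (exp (fromℕ j)))))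
    (S.≈-trans (S.≈-sym (S.*-∑ (exp (M ℚ.* x) *ₛ σ M β) (upTo m) (λ j → exp (fromℕ j))))
    (S.≈-trans (S.*-assoc (exp (M ℚ.* x)) (σ M β) _)
    (S.≈-trans (S.*-congˡ (raabe m))
      (S.solve 3 (λ e c b → e S.:* (c S.:* b) S.:= c S.:* (b S.:* e)) S.≈-refl (exp (M ℚ.* x)) (const M) β))))
    where module S = SeriesRing

-- This is n! times coefficient n + 1 of `weighted-sum`, whose factor t shifts the index by one. The
-- term N t β becomes N Bₙ, and the product β(t) β(Nt) becomes the double sum.
bernoulliPoly-weighted-sum : ∀ N .{{_ : NonZero N}} n →
  fromℕ N ^ n ℚ.* FiniteSum.∑ ℚ.+-0-rawMonoid (upTo N) (λ k → (+ k / N) ℚ.* bernoulliPoly n (+ k / N))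
  ≡ FiniteSum.∑ ℚ.+-0-rawMonoid (upTo (2 ℕ.+ n))
      (λ i → (_/_ (+ (n ! ℕ.* N ℕ.^ (suc n ℕ.∸ i))) (i ! ℕ.* (suc n ℕ.∸ i) !) {{i !* (suc n ℕ.∸ i) !≢0}})
             ℚ.* bernoulli i ℚ.* bernoulli (suc n ℕ.∸ i))
    ℚ.+ (+ n / suc n) ℚ.* bernoulli (suc n) ℚ.+ fromℕ N ℚ.* bernoulli n
bernoulliPoly-weighted-sum N n = begin
  M ^ n ℚ.* (∑[ k ∈ upTo N ] (+ k / N) ℚ.* bernoulliPoly n (+ k / N))
    ≡⟨ cong (M ^ n ℚ.*_) (trans (∑-cong (upTo N) (λ k → trans (cong ((+ k / N) ℚ.*_) (bernoulliPoly-coeff n (+ k / N)))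
           (solve 3 (λ w f s → w :* (f :* s) := f :* (w :* s)) refl (+ k / N) F (coeff (β *ₛ exp (+ k / N)) n))))
         (sym (*-∑ F (upTo N) _))) ⟩
  M ^ n ℚ.* (F ℚ.* (∑[ k ∈ upTo N ] (+ k / N) ℚ.* coeff (β *ₛ exp (+ k / N)) n))
    ≡⟨ solve 3 (λ p f s → p :* (f :* s) := f :* (p :* s)) refl (M ^ n) F _ ⟩
  F ℚ.* (M ^ n ℚ.* (∑[ k ∈ upTo N ] (+ k / N) ℚ.* coeff (β *ₛ exp (+ k / N)) n))
    ≡⟨ cong (F ℚ.*_) coefficient ⟩
  F ℚ.* (M ℚ.* βₙ ℚ.+ βσβ ℚ.- βₙ ℚ.- ββ)
    ≡⟨ solve 5 (λ f m b s c → f :* (m :* b :+ s :- b :- c) := f :* s :+ f :* (:- b :- c) :+ m :* (f :* b)) refl F M βₙ βσβ ββ ⟩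
  F ℚ.* βσβ ℚ.+ F ℚ.* (ℚ.- βₙ ℚ.- ββ) ℚ.+ M ℚ.* (F ℚ.* βₙ)
    ≡⟨ cong₂ (λ x y → F ℚ.* βσβ ℚ.+ x ℚ.+ M ℚ.* y) next this ⟩
  F ℚ.* βσβ ℚ.+ (+ n / suc n) ℚ.* bernoulli (suc n) ℚ.+ M ℚ.* bernoulli n
    ≡⟨ cong (λ x → x ℚ.+ (+ n / suc n) ℚ.* bernoulli (suc n) ℚ.+ M ℚ.* bernoulli n) product ⟩
  _ ∎
  where
  open ≡-Reasoning
  open FiniteSum ℚ.+-0-rawMonoid
  open ℚSums
  open ℚ.+-*-Solver
  module S = SeriesRing
  M   = fromℕ N
  F   = fromℕ (n !)
  βₙ  = coeff β n
  βσβ = coeff (β *ₛ σ M β) (suc n)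
  ββ  = coeff (β *ₛ β) (suc n)

  this : F ℚ.* βₙ ≡ bernoulli n
  this = trans (solve 3 (λ f b e → f :* (b :* e) := (f :* e) :* b) refl F (bernoulli n) (invFact n))
    (trans (cong (ℚ._* bernoulli n) (fact-invFact n)) (ℚ.*-identityˡ _))

  next : F ℚ.* (ℚ.- βₙ ℚ.- ββ) ≡ (+ n / suc n) ℚ.* bernoulli (suc n)
  next = begin
    F ℚ.* (ℚ.- βₙ ℚ.- ββ)
      -- Coefficient n + 1 of β is added and subtracted to expose that of θβ; the difference of n +
      -- 1 copies and one copy leaves the factor n.
      ≡⟨ solve 4 (λ f b c d → f :* (:- b :- c) := f :* ((d :- b :- c) :- d)) refl F βₙ ββ (coeff β (suc n)) ⟩
    F ℚ.* ((coeff β (suc n) ℚ.- βₙ ℚ.- ββ) ℚ.- coeff β (suc n))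
      ≡⟨ cong (λ x → F ℚ.* (x ℚ.- coeff β (suc n))) (trans (cong (λ x → coeff β (suc n) ℚ.- x ℚ.- ββ) (sym (coeff-X* β n))) (sym (at θ-β (suc n)))) ⟩
    F ℚ.* (fromℕ (suc n) ℚ.* coeff β (suc n) ℚ.- coeff β (suc n))
      ≡⟨ cong (λ x → F ℚ.* (x ℚ.* coeff β (suc n) ℚ.- coeff β (suc n))) (fromℕ-suc n) ⟩
    F ℚ.* ((1ℚ ℚ.+ fromℕ n) ℚ.* coeff β (suc n) ℚ.- coeff β (suc n))
      ≡⟨ solve 5 (λ f k b r e → f :* ((con 1ℚ :+ k) :* (b :* (con 1ℚ :* r :* e)) :- b :* (con 1ℚ :* r :* e)) := (f :* e) :* (k :* r :* b)) refl
           F (fromℕ n) (bernoulli (suc n)) (recip (suc n)) (invFact n) ⟩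
    F ℚ.* invFact n ℚ.* (fromℕ n ℚ.* recip (suc n) ℚ.* bernoulli (suc n))
      ≡⟨ trans (cong (ℚ._* (fromℕ n ℚ.* recip (suc n) ℚ.* bernoulli (suc n))) (fact-invFact n)) (ℚ.*-identityˡ _) ⟩
    fromℕ n ℚ.* recip (suc n) ℚ.* bernoulli (suc n)
      ≡⟨ cong (ℚ._* bernoulli (suc n)) (/-split n (suc n)) ⟨
    (+ n / suc n) ℚ.* bernoulli (suc n) ∎

  coefficient : M ^ n ℚ.* (∑[ k ∈ upTo N ] (+ k / N) ℚ.* coeff (β *ₛ exp (+ k / N)) n)
                ≡ M ℚ.* βₙ ℚ.+ βσβ ℚ.- βₙ ℚ.- ββ
  coefficient = begin
    M ^ n ℚ.* (∑[ k ∈ upTo N ] (+ k / N) ℚ.* coeff (β *ₛ exp (+ k / N)) n)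
      ≡⟨ *-∑ (M ^ n) (upTo N) _ ⟩
    (∑[ k ∈ upTo N ] M ^ n ℚ.* ((+ k / N) ℚ.* coeff (β *ₛ exp (+ k / N)) n))
      ≡⟨ ∑-cong (upTo N) (λ k → trans
           (solve 3 (λ p w s → p :* (w :* s) := w :* (p :* s)) refl (M ^ n) (+ k / N) (coeff (β *ₛ exp (+ k / N)) n))
           (trans (cong ((+ k / N) ℚ.*_) (at (scaled k) n)) (sym (const-*ₛ (+ k / N) (σ M β *ₛ exp (fromℕ k)) n)))) ⟩
    (∑[ k ∈ upTo N ] coeff (const (+ k / N) *ₛ (σ M β *ₛ exp (fromℕ k))) n)
      ≡⟨ coeff-∑ (upTo N) _ n ⟨
    coeff (S.∑ (upTo N) (λ k → const (+ k / N) *ₛ (σ M β *ₛ exp (fromℕ k)))) n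
      ≡⟨ at (S.≈-trans (S.∑-cong (upTo N) (λ k → S.solve 3 (λ w s e → w S.:* (s S.:* e) S.:= s S.:* (w S.:* e)) S.≈-refl
                (const (+ k / N)) (σ M β) (exp (fromℕ k)))) (S.≈-sym (S.*-∑ (σ M β) (upTo N) _))) n ⟩
    coeff (σ M β *ₛ S.∑ (upTo N) (λ k → const (+ k / N) *ₛ exp (fromℕ k))) n
      ≡⟨ coeff-X* (σ M β *ₛ S.∑ (upTo N) (λ k → const (+ k / N) *ₛ exp (fromℕ k))) n ⟨
    coeff (X *ₛ (σ M β *ₛ S.∑ (upTo N) (λ k → const (+ k / N) *ₛ exp (fromℕ k)))) (suc n)
      ≡⟨ at (weighted-sum N) (suc n) ⟩
    coeff (const M *ₛ (X *ₛ β)) (suc n) ℚ.+ βσβ ℚ.- coeff (X *ₛ β) (suc n) ℚ.- ββ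
      ≡⟨ cong₂ (λ x y → x ℚ.+ βσβ ℚ.- y ℚ.- ββ)
           (trans (const-*ₛ M (X *ₛ β) (suc n)) (cong (M ℚ.*_) (coeff-X* β n))) (coeff-X* β n) ⟩
    M ℚ.* βₙ ℚ.+ βσβ ℚ.- βₙ ℚ.- ββ ∎
    where
    scaled : ∀ k → σ M (β *ₛ exp (+ k / N)) ≗ₛ σ M β *ₛ exp (fromℕ k)
    scaled k = S.≈-trans (σ-* M β (exp (+ k / N)))
      (S.*-congˡ (S.≈-trans (σ-exp M (+ k / N)) (S.reflexive (cong exp (fromℕ-*-/ k N)))))

  product : F ℚ.* βσβ ≡ ∑[ i ∈ upTo (2 ℕ.+ n) ]
    (_/_ (+ (n ! ℕ.* N ℕ.^ (suc n ℕ.∸ i))) (i ! ℕ.* (suc n ℕ.∸ i) !) {{i !* (suc n ℕ.∸ i) !≢0}})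
      ℚ.* bernoulli i ℚ.* bernoulli (suc n ℕ.∸ i)
  product = begin
    F ℚ.* conv (coeff β) (coeff (σ M β)) (suc n)
      ≡⟨ cong (F ℚ.*_) (conv-explicit (coeff β) (coeff (σ M β)) (suc n)) ⟩
    F ℚ.* (∑[ i ∈ upTo (2 ℕ.+ n) ] coeff β i ℚ.* coeff (σ M β) (suc n ℕ.∸ i))
      ≡⟨ *-∑ F (upTo (2 ℕ.+ n)) _ ⟩
    (∑[ i ∈ upTo (2 ℕ.+ n) ] F ℚ.* (coeff β i ℚ.* coeff (σ M β) (suc n ℕ.∸ i)))
      ≡⟨ ∑-cong (upTo (2 ℕ.+ n)) (λ i → term i (suc n ℕ.∸ i)) ⟩
    _ ∎
    where
    term : ∀ i j → F ℚ.* (coeff β i ℚ.* (M ^ j ℚ.* coeff β j))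
           ≡ (_/_ (+ (n ! ℕ.* N ℕ.^ j)) (i ! ℕ.* j !) {{i !* j !≢0}}) ℚ.* bernoulli i ℚ.* bernoulli j
    term i j = begin
      F ℚ.* (bernoulli i ℚ.* invFact i ℚ.* (M ^ j ℚ.* (bernoulli j ℚ.* invFact j)))
        ≡⟨ solve 6 (λ f x d p y e → f :* (x :* d :* (p :* (y :* e))) := f :* p :* (d :* e) :* x :* y) refl
             F (bernoulli i) (invFact i) (M ^ j) (bernoulli j) (invFact j) ⟩
      F ℚ.* M ^ j ℚ.* (invFact i ℚ.* invFact j) ℚ.* bernoulli i ℚ.* bernoulli j
        ≡⟨ cong (λ x → x ℚ.* bernoulli i ℚ.* bernoulli j) (cong₂ ℚ._*_
             (trans (cong (F ℚ.*_) (sym (fromℕ-^ N j))) (sym (fromℕ-* (n !) (N ℕ.^ j))))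
             (trans (cong₂ ℚ._*_ (sym (recip-! i {{i !≢0}})) (sym (recip-! j {{j !≢0}})))
               (recip-* (i !) (j !) {{i !≢0}} {{j !≢0}}))) ⟩
      fromℕ (n ! ℕ.* N ℕ.^ j) ℚ.* recip (i ! ℕ.* j !) {{i !* j !≢0}} ℚ.* bernoulli i ℚ.* bernoulli j
        ≡⟨ cong (λ x → x ℚ.* bernoulli i ℚ.* bernoulli j) (/-split (n ! ℕ.* N ℕ.^ j) (i ! ℕ.* j !) {{i !* j !≢0}}) ⟨
      (_/_ (+ (n ! ℕ.* N ℕ.^ j)) (i ! ℕ.* j !) {{i !* j !≢0}}) ℚ.* bernoulli i ℚ.* bernoulli j ∎

-- Bernoulli functions

open Exp (CommutativeRing.commutativeSemiring ℚ.+-*-commutativeRing) using (^-homo-*; ^-distrib-*)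

/1-cancel-< : ∀ {p q} → p / 1 ℚ.< q / 1 → p ℤ.< q
/1-cancel-< {p} {q} p<q = subst₂ ℤ._<_ (ℤ.*-identityʳ p) (ℤ.*-identityʳ q)
  (ℚᵘ.drop-*<* (ℚᵘ.<-respˡ-≃ (/-toℚᵘ p 1) (ℚᵘ.<-respʳ-≃ (/-toℚᵘ q 1) (ℚ.toℚᵘ-mono-< p<q))))

/1-suc : ∀ q → ℤ.suc q / 1 ≡ 1ℚ ℚ.+ (q / 1)
/1-suc q = trans (cong (λ r → (+ 1 ℤ.+ r) / 1) (sym (ℤ.*-identityʳ q))) (sym (/-+ (+ 1) q 1 1))

floor-≤ : ∀ x → floor x / 1 ℚ.≤ x
floor-≤ x@(mkℚ n d _) = ℚ.toℚᵘ-cancel-≤ (ℚᵘ.≤-respˡ-≃ (ℚᵘ.≃-sym (/-toℚᵘ (floor x) 1))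
  (ℚᵘ.*≤* (subst (floor x ℤ.* + suc d ℤ.≤_) (sym (ℤ.*-identityʳ n)) ([n/d]*d≤n n (+ suc d)))))

<-suc-floor : ∀ x → x ℚ.< ℤ.suc (floor x) / 1
<-suc-floor x@(mkℚ n d _) = ℚ.toℚᵘ-cancel-< (ℚᵘ.<-respʳ-≃ (ℚᵘ.≃-sym (/-toℚᵘ (ℤ.suc (floor x)) 1))
  (ℚᵘ.*<* (subst₂ ℤ._<_ (sym (ℤ.*-identityʳ n))
    (cong (λ q → ℤ.suc q ℤ.* + suc d) (sym (div-pos-is-/ℕ n (suc d)))) (n<s[n/ℕd]*d n (suc d)))))

-- Both q < floor x + 1 and floor x < q + 1 hold, and for integers i < j + 1 means i ≤ j.
floor-unique : ∀ q x → q / 1 ℚ.≤ x → x ℚ.< ℤ.suc q / 1 → floor x ≡ q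
floor-unique q x q≤x x<q+1 = ℤ.≤-antisym
  (below (ℚ.≤-<-trans (floor-≤ x) x<q+1))
  (below (ℚ.≤-<-trans q≤x (<-suc-floor x)))
  where
  below : ∀ {i j} → i / 1 ℚ.< ℤ.suc j / 1 → i ℤ.≤ j
  below {i} {j} i<j+1 = subst (i ℤ.≤_) (ℤ.pred-suc j) (ℤ.i<j⇒i≤pred[j] {i} {ℤ.suc j} (/1-cancel-< {i} {ℤ.suc j} i<j+1))

floor-1+ : ∀ x → floor (1ℚ ℚ.+ x) ≡ ℤ.suc (floor x)
floor-1+ x = floor-unique (ℤ.suc (floor x)) (1ℚ ℚ.+ x)
  (subst (ℚ._≤ 1ℚ ℚ.+ x) (sym (/1-suc (floor x))) (ℚ.+-monoʳ-≤ 1ℚ (floor-≤ x)))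
  (subst (1ℚ ℚ.+ x ℚ.<_) (sym (/1-suc (ℤ.suc (floor x)))) (ℚ.+-monoʳ-< 1ℚ (<-suc-floor x)))

floor-proper : ∀ k d .{{_ : NonZero d}} → k < d → floor (+ k / d) ≡ + 0
floor-proper k d@(suc d-1) k<d = floor-unique (+ 0) (+ k / d)
  (ℚ.nonNegative⁻¹ (+ k / d) {{ℚ.normalize-nonNeg k d}})
  (ℚ.toℚᵘ-cancel-< (ℚᵘ.<-respˡ-≃ (ℚᵘ.≃-sym (/-toℚᵘ (+ k) d))
    (ℚᵘ.*<* (subst₂ ℤ._<_ (sym (ℤ.*-identityʳ (+ k))) (sym (ℤ.*-identityˡ (+ d))) (ℤ.+<+ k<d)))))

module _ (n : ℕ) where
  open ≡-Reasoning
  open FiniteSum ℚ.+-0-rawMonoid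
  open ℚSums
  open ℚ.+-*-Solver

  bernoulliFun-1+ : ∀ x → bernoulliFun n (1ℚ ℚ.+ x) ≡ bernoulliFun n x
  bernoulliFun-1+ x = cong (bernoulliPoly n) (begin
    (1ℚ ℚ.+ x) ℚ.- (floor (1ℚ ℚ.+ x) / 1)    ≡⟨ cong (λ q → (1ℚ ℚ.+ x) ℚ.- (q / 1)) (floor-1+ x) ⟩
    (1ℚ ℚ.+ x) ℚ.- (ℤ.suc (floor x) / 1)     ≡⟨ cong (λ y → (1ℚ ℚ.+ x) ℚ.- y) (/1-suc (floor x)) ⟩
    (1ℚ ℚ.+ x) ℚ.- (1ℚ ℚ.+ (floor x / 1))    ≡⟨ solve 2 (λ x y → (con 1ℚ :+ x) :- (con 1ℚ :+ y) := x :- y) refl x (floor x / 1) ⟩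
    x ℚ.- (floor x / 1)                      ∎)

  bernoulliFun-+ℕ : ∀ m x → bernoulliFun n (x ℚ.+ fromℕ m) ≡ bernoulliFun n x
  bernoulliFun-+ℕ zero    x = cong (bernoulliFun n) (ℚ.+-identityʳ x)
  bernoulliFun-+ℕ (suc m) x = begin
    bernoulliFun n (x ℚ.+ fromℕ (suc m))         ≡⟨ cong (λ y → bernoulliFun n (x ℚ.+ y)) (fromℕ-suc m) ⟩
    bernoulliFun n (x ℚ.+ (1ℚ ℚ.+ fromℕ m))      ≡⟨ cong (bernoulliFun n) (solve 2 (λ x y → x :+ (con 1ℚ :+ y) := con 1ℚ :+ (x :+ y)) refl x (fromℕ m)) ⟩
    bernoulliFun n (1ℚ ℚ.+ (x ℚ.+ fromℕ m))      ≡⟨ bernoulliFun-1+ (x ℚ.+ fromℕ m) ⟩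
    bernoulliFun n (x ℚ.+ fromℕ m)               ≡⟨ bernoulliFun-+ℕ m x ⟩
    bernoulliFun n x                             ∎

  bernoulliFun-proper : ∀ k d .{{_ : NonZero d}} → k < d → bernoulliFun n (+ k / d) ≡ bernoulliPoly n (+ k / d)
  bernoulliFun-proper k d k<d = cong (bernoulliPoly n)
    (trans (cong (λ q → (+ k / d) ℚ.- (q / 1)) (floor-proper k d k<d)) (ℚ.+-identityʳ _))

  -- With i a = s + m b, the points i/b + j/a are s/(ab) + (m + j)/a: by periodicity m can be dropped.
  bernoulliFun-multiplication : ∀ a b .{{_ : NonZero a}} .{{_ : NonZero b}} i →
    bernoulliFun n (+ (i ℕ.* a) / b) ≡
    fromℕ a ^ n ℚ.* recip a ℚ.* (∑[ j ∈ upTo a ] bernoulliFun n ((+ i / b) ℚ.+ (+ j / a)))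
  bernoulliFun-multiplication a b i = sym (begin
    A ^ n ℚ.* recip a ℚ.* (∑[ j ∈ upTo a ] bernoulliFun n ((+ i / b) ℚ.+ (+ j / a)))
      ≡⟨ cong (A ^ n ℚ.* recip a ℚ.*_) (begin
           (∑[ j ∈ upTo a ] bernoulliFun n ((+ i / b) ℚ.+ (+ j / a)))  ≡⟨ ∑-cong (upTo a) (λ j → cong (bernoulliFun n) (shift j)) ⟩
           (∑[ j ∈ upTo a ] g (m ℕ.+ j))                               ≡⟨ ∑-shift a m g-periodic ⟩
           -- Because s < b and j < a, each argument s/(ab) + j/a lies in [0, 1), where the
           -- Bernoulli function is the polynomial.
           (∑[ j ∈ upTo a ] g j)                                       ≡⟨ ∑-cong-< a proper ⟩
           (∑[ j ∈ upTo a ] bernoulliPoly n (x₀ ℚ.+ (+ j / a)))        ∎) ⟩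
    A ^ n ℚ.* recip a ℚ.* P
      ≡⟨ solve 3 (λ p r s → p :* r :* s := r :* (p :* s)) refl (A ^ n) (recip a) P ⟩
    recip a ℚ.* (A ^ n ℚ.* P)
      ≡⟨ cong (recip a ℚ.*_) (bernoulliPoly-multiplication a n x₀) ⟩
    recip a ℚ.* (A ℚ.* bernoulliPoly n (A ℚ.* x₀))
      ≡⟨ solve 3 (λ r x y → r :* (x :* y) := (x :* r) :* y) refl (recip a) A _ ⟩
    A ℚ.* recip a ℚ.* bernoulliPoly n (A ℚ.* x₀)
      ≡⟨ cong₂ (λ x y → x ℚ.* bernoulliPoly n y) (fromℕ-recip a) Ax₀ ⟩
    1ℚ ℚ.* bernoulliPoly n (+ s / b)
      ≡⟨ ℚ.*-identityˡ _ ⟩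
    bernoulliPoly n (+ s / b)
      ≡⟨ bernoulliFun-proper s b (m%n<n (i ℕ.* a) b) ⟨
    bernoulliFun n (+ s / b)
      ≡⟨ bernoulliFun-+ℕ m (+ s / b) ⟨
    bernoulliFun n ((+ s / b) ℚ.+ fromℕ m)
      ≡⟨ cong (bernoulliFun n) remainder ⟨
    bernoulliFun n (+ (i ℕ.* a) / b) ∎)
    where
    A = fromℕ a
    s = (i ℕ.* a) % b
    m = (i ℕ.* a) ℕ./ b
    x₀ = (+ s / b) ℚ.* recip a
    P = ∑[ j ∈ upTo a ] bernoulliPoly n (x₀ ℚ.+ (+ j / a))

    g : ℕ → ℚ
    g k = bernoulliFun n (x₀ ℚ.+ (+ k / a))

    g-periodic : ∀ k → g (k ℕ.+ a) ≡ g k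
    g-periodic k = trans
      (cong (bernoulliFun n) (trans (cong (x₀ ℚ.+_) (sym (/-+1 k a)))
        (solve 2 (λ x y → x :+ (y :+ con 1ℚ) := con 1ℚ :+ (x :+ y)) refl x₀ (+ k / a))))
      (bernoulliFun-1+ (x₀ ℚ.+ (+ k / a)))

    remainder : + (i ℕ.* a) / b ≡ (+ s / b) ℚ.+ fromℕ m
    remainder = begin
      + (i ℕ.* a) / b
        ≡⟨ /-split (i ℕ.* a) b ⟩
      fromℕ (i ℕ.* a) ℚ.* recip b
        ≡⟨ cong (λ k → fromℕ k ℚ.* recip b) (m≡m%n+[m/n]*n (i ℕ.* a) b) ⟩
      fromℕ (s ℕ.+ m ℕ.* b) ℚ.* recip b
        ≡⟨ cong (ℚ._* recip b) (trans (fromℕ-+ s (m ℕ.* b)) (cong (fromℕ s ℚ.+_) (fromℕ-* m b))) ⟩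
      (fromℕ s ℚ.+ fromℕ m ℚ.* fromℕ b) ℚ.* recip b
        ≡⟨ solve 4 (λ s m b r → (s :+ m :* b) :* r := s :* r :+ m :* (b :* r)) refl (fromℕ s) (fromℕ m) (fromℕ b) (recip b) ⟩
      fromℕ s ℚ.* recip b ℚ.+ fromℕ m ℚ.* (fromℕ b ℚ.* recip b)
        ≡⟨ cong₂ (λ x y → x ℚ.+ fromℕ m ℚ.* y) (sym (/-split s b)) (fromℕ-recip b) ⟩
      (+ s / b) ℚ.+ fromℕ m ℚ.* 1ℚ
        ≡⟨ cong ((+ s / b) ℚ.+_) (ℚ.*-identityʳ (fromℕ m)) ⟩
      (+ s / b) ℚ.+ fromℕ m ∎

    i/b : + i / b ≡ x₀ ℚ.+ fromℕ m ℚ.* recip a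
    i/b = begin
      + i / b                                        ≡⟨ /-split i b ⟩
      fromℕ i ℚ.* recip b                            ≡⟨ solve 2 (λ i r → i :* r := i :* con 1ℚ :* r) refl (fromℕ i) (recip b) ⟩
      fromℕ i ℚ.* 1ℚ ℚ.* recip b                     ≡⟨ cong (λ x → fromℕ i ℚ.* x ℚ.* recip b) (fromℕ-recip a) ⟨
      fromℕ i ℚ.* (A ℚ.* recip a) ℚ.* recip b        ≡⟨ solve 4 (λ i a r s → i :* (a :* r) :* s := (i :* a) :* s :* r) refl (fromℕ i) A (recip a) (recip b) ⟩
      fromℕ i ℚ.* A ℚ.* recip b ℚ.* recip a          ≡⟨ cong (λ x → x ℚ.* recip b ℚ.* recip a) (fromℕ-* i a) ⟨
      fromℕ (i ℕ.* a) ℚ.* recip b ℚ.* recip a        ≡⟨ cong (ℚ._* recip a) (trans (sym (/-split (i ℕ.* a) b)) remainder) ⟩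
      ((+ s / b) ℚ.+ fromℕ m) ℚ.* recip a            ≡⟨ ℚ.*-distribʳ-+ (recip a) (+ s / b) (fromℕ m) ⟩
      x₀ ℚ.+ fromℕ m ℚ.* recip a                     ∎

    shift : ∀ j → (+ i / b) ℚ.+ (+ j / a) ≡ x₀ ℚ.+ (+ (m ℕ.+ j) / a)
    shift j = begin
      (+ i / b) ℚ.+ (+ j / a)                                  ≡⟨ cong₂ ℚ._+_ i/b (/-split j a) ⟩
      x₀ ℚ.+ fromℕ m ℚ.* recip a ℚ.+ fromℕ j ℚ.* recip a       ≡⟨ solve 4 (λ x m j r → x :+ m :* r :+ j :* r := x :+ (m :+ j) :* r) refl x₀ (fromℕ m) (fromℕ j) (recip a) ⟩
      x₀ ℚ.+ (fromℕ m ℚ.+ fromℕ j) ℚ.* recip a                 ≡⟨ cong (λ y → x₀ ℚ.+ y ℚ.* recip a) (fromℕ-+ m j) ⟨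
      x₀ ℚ.+ fromℕ (m ℕ.+ j) ℚ.* recip a                       ≡⟨ cong (x₀ ℚ.+_) (/-split (m ℕ.+ j) a) ⟨
      x₀ ℚ.+ (+ (m ℕ.+ j) / a)                                 ∎

    Ax₀ : A ℚ.* x₀ ≡ + s / b
    Ax₀ = trans (solve 3 (λ a x r → a :* (x :* r) := (a :* r) :* x) refl A (+ s / b) (recip a))
      (trans (cong (ℚ._* (+ s / b)) (fromℕ-recip a)) (ℚ.*-identityˡ _))

    proper : ∀ j → j < a → g j ≡ bernoulliPoly n (x₀ ℚ.+ (+ j / a))
    proper j j<a = begin
      bernoulliFun n (x₀ ℚ.+ (+ j / a))                   ≡⟨ cong (bernoulliFun n) combine ⟩
      bernoulliFun n (+ (s ℕ.+ j ℕ.* b) / (b ℕ.* a))      ≡⟨ bernoulliFun-proper (s ℕ.+ j ℕ.* b) (b ℕ.* a) s+jb<ba ⟩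
      bernoulliPoly n (+ (s ℕ.+ j ℕ.* b) / (b ℕ.* a))     ≡⟨ cong (bernoulliPoly n) combine ⟨
      bernoulliPoly n (x₀ ℚ.+ (+ j / a))                  ∎
      where
      instance
        ba≢0 : NonZero (b ℕ.* a)
        ba≢0 = m*n≢0 b a

      s+jb<ba : s ℕ.+ j ℕ.* b < b ℕ.* a
      s+jb<ba = ℕ.<-≤-trans (ℕ.+-monoˡ-< (j ℕ.* b) (m%n<n (i ℕ.* a) b))
        (subst (suc j ℕ.* b ≤_) (ℕ.*-comm a b) (ℕ.*-monoˡ-≤ b j<a))

      combine : x₀ ℚ.+ (+ j / a) ≡ + (s ℕ.+ j ℕ.* b) / (b ℕ.* a)
      combine = begin
        (+ s / b) ℚ.* recip a ℚ.+ (+ j / a)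
          ≡⟨ cong₂ (λ x y → x ℚ.* recip a ℚ.+ y) (/-split s b) (/-split j a) ⟩
        fromℕ s ℚ.* recip b ℚ.* recip a ℚ.+ fromℕ j ℚ.* recip a
          ≡⟨ solve 4 (λ s j p q → s :* p :* q :+ j :* q := (s :* con 1ℚ) :* (p :* q) :+ j :* con 1ℚ :* q) refl (fromℕ s) (fromℕ j) (recip b) (recip a) ⟩
        fromℕ s ℚ.* 1ℚ ℚ.* (recip b ℚ.* recip a) ℚ.+ fromℕ j ℚ.* 1ℚ ℚ.* recip a
          ≡⟨ cong (λ x → fromℕ s ℚ.* 1ℚ ℚ.* (recip b ℚ.* recip a) ℚ.+ fromℕ j ℚ.* x ℚ.* recip a) (fromℕ-recip b) ⟨
        fromℕ s ℚ.* 1ℚ ℚ.* (recip b ℚ.* recip a) ℚ.+ fromℕ j ℚ.* (fromℕ b ℚ.* recip b) ℚ.* recip a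
          ≡⟨ solve 5 (λ s j b p q → s :* con 1ℚ :* (p :* q) :+ j :* (b :* p) :* q := (s :+ j :* b) :* (p :* q)) refl (fromℕ s) (fromℕ j) (fromℕ b) (recip b) (recip a) ⟩
        (fromℕ s ℚ.+ fromℕ j ℚ.* fromℕ b) ℚ.* (recip b ℚ.* recip a)
          ≡⟨ cong₂ ℚ._*_ (trans (cong (fromℕ s ℚ.+_) (sym (fromℕ-* j b))) (sym (fromℕ-+ s (j ℕ.* b)))) (recip-* b a) ⟩
        fromℕ (s ℕ.+ j ℕ.* b) ℚ.* recip (b ℕ.* a)
          ≡⟨ /-split (s ℕ.+ j ℕ.* b) (b ℕ.* a) ⟨
        + (s ℕ.+ j ℕ.* b) / (b ℕ.* a) ∎

-- Apostol-Dedekind sums and Sylvester sums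

apostolDedekind-upTo : ∀ n a b .{{_ : NonZero b}} → apostolDedekind n a b ≡
  FiniteSum.∑ ℚ.+-0-rawMonoid (upTo b) (λ i → (+ i / b) ℚ.* bernoulliFun n (+ (i ℕ.* a) / b))
apostolDedekind-upTo n a b@(suc b-1) = sym (begin
  -- The definition starts at k = 1; the extra term k = 0 has weight 0.
  (+ 0 / b) ℚ.* bernoulliFun n (+ 0 / b) ℚ.+ apostolDedekind n a b
    ≡⟨ cong (λ x → x ℚ.* bernoulliFun n (+ 0 / b) ℚ.+ apostolDedekind n a b) (ℚ.0/n≡0 b) ⟩
  ℚ.0ℚ ℚ.* bernoulliFun n (+ 0 / b) ℚ.+ apostolDedekind n a b
    ≡⟨ cong (ℚ._+ apostolDedekind n a b) (ℚ.*-zeroˡ (bernoulliFun n (+ 0 / b))) ⟩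
  ℚ.0ℚ ℚ.+ apostolDedekind n a b
    ≡⟨ ℚ.+-identityˡ _ ⟩
  apostolDedekind n a b ∎)
  where open ≡-Reasoning

fromℕ-∑ : ∀ ks (g : ℕ → ℕ) → fromℕ (FiniteSum.∑ ℕ.+-0-rawMonoid ks g)
          ≡ FiniteSum.∑ ℚ.+-0-rawMonoid ks (λ k → fromℕ (g k))
fromℕ-∑ []       g = refl
fromℕ-∑ (k ∷ ks) g = trans (fromℕ-+ (g k) _) (cong (fromℕ (g k) ℚ.+_) (fromℕ-∑ ks g))

module _ (a b : ℕ) .{{_ : NonZero a}} .{{_ : NonZero b}} where
  open ≡-Reasoning
  open FiniteSum ℚ.+-0-rawMonoid
  open ℚSums
  open ℚ.+-*-Solver
  private
    N = a ℕ.* b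

    instance
      ab≢0 : NonZero (a ℕ.* b)
      ab≢0 = m*n≢0 a b

  -- Splitting Nⁿ as Nⁱ Nⁿ⁻ⁱ, the second factor clears the denominator of (k/N)ⁿ⁻ⁱ and leaves the
  -- power of k that a Sylvester sum collects.
  bernoulliPoly-scaled : ∀ n k → fromℕ N ^ n ℚ.* bernoulliPoly n (+ k / N) ≡
    ∑[ i ∈ upTo (suc n) ] fromℕ ((n C i) ℕ.* N ℕ.^ i) ℚ.* bernoulli i ℚ.* fromℕ (k ℕ.^ (n ℕ.∸ i))
  bernoulliPoly-scaled n k = trans (*-∑ (fromℕ N ^ n) (upTo (suc n)) _)
    (∑-cong-< (suc n) (λ i i≤n → begin
      fromℕ N ^ n ℚ.* (fromℕ (n C i) ℚ.* bernoulli i ℚ.* (+ k / N) ^ (n ℕ.∸ i))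
        ≡⟨ cong (λ p → p ℚ.* (fromℕ (n C i) ℚ.* bernoulli i ℚ.* (+ k / N) ^ (n ℕ.∸ i)))
             (trans (cong (fromℕ N ^_) (sym (ℕ.m+[n∸m]≡n (ℕ.≤-pred i≤n)))) (^-homo-* (fromℕ N) i (n ℕ.∸ i))) ⟩
      fromℕ N ^ i ℚ.* fromℕ N ^ (n ℕ.∸ i) ℚ.* (fromℕ (n C i) ℚ.* bernoulli i ℚ.* (+ k / N) ^ (n ℕ.∸ i))
        ≡⟨ solve 5 (λ p q c x y → p :* q :* (c :* x :* y) := (c :* p) :* x :* (q :* y)) refl
             (fromℕ N ^ i) (fromℕ N ^ (n ℕ.∸ i)) (fromℕ (n C i)) (bernoulli i) ((+ k / N) ^ (n ℕ.∸ i)) ⟩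
      fromℕ (n C i) ℚ.* fromℕ N ^ i ℚ.* bernoulli i ℚ.* (fromℕ N ^ (n ℕ.∸ i) ℚ.* (+ k / N) ^ (n ℕ.∸ i))
        ≡⟨ cong₂ (λ x y → x ℚ.* bernoulli i ℚ.* y)
             (trans (cong (fromℕ (n C i) ℚ.*_) (sym (fromℕ-^ N i))) (sym (fromℕ-* (n C i) (N ℕ.^ i))))
             (trans (sym (^-distrib-* (fromℕ N) (+ k / N) (n ℕ.∸ i)))
               (trans (cong (_^ (n ℕ.∸ i)) (fromℕ-*-/ k N)) (sym (fromℕ-^ k (n ℕ.∸ i))))) ⟩
      fromℕ ((n C i) ℕ.* N ℕ.^ i) ℚ.* bernoulli i ℚ.* fromℕ (k ℕ.^ (n ℕ.∸ i)) ∎))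

  sylvesterPart bernoulliPart : ℕ → ℚ
  sylvesterPart n = ∑[ i ∈ upTo (suc n) ]
    fromℕ ((n C i) ℕ.* N ℕ.^ i) ℚ.* bernoulli i ℚ.* fromℕ (sylvesterSum a b (n ℕ.∸ i))
  bernoulliPart n = ∑[ i ∈ upTo (suc (suc n)) ]
    (_/_ (+ (n ! ℕ.* N ℕ.^ (suc n ℕ.∸ i))) (i ! ℕ.* (suc n ℕ.∸ i) !) {{i !* (suc n ℕ.∸ i) !≢0}})
      ℚ.* bernoulli i ℚ.* bernoulli (suc n ℕ.∸ i)

  -- Every gap is below ab, so the polynomial may replace the Bernoulli function; exchanging the
  -- sums then collects the powers of the gaps.
  gap-sum : ∀ n → fromℕ N ^ n ℚ.* (∑[ k ∈ gaps a b ] bernoulliFun n (+ k / N)) ≡ sylvesterPart n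
  gap-sum n = begin
    fromℕ N ^ n ℚ.* (∑[ k ∈ gaps a b ] bernoulliFun n (+ k / N))
      ≡⟨ *-∑ (fromℕ N ^ n) (gaps a b) _ ⟩
    (∑[ k ∈ gaps a b ] fromℕ N ^ n ℚ.* bernoulliFun n (+ k / N))
      ≡⟨ ∑-cong-∈ (gaps a b) (λ {k} k∈ → trans
           (cong (fromℕ N ^ n ℚ.*_) (bernoulliFun-proper n k N
             (∈-upTo⁻ (proj₁ (∈-filter⁻ (¬? ∘ inSemigroup? a b) {xs = upTo N} k∈)))))
           (bernoulliPoly-scaled n k)) ⟩
    (∑[ k ∈ gaps a b ] (∑[ i ∈ upTo (suc n) ] w i ℚ.* fromℕ (k ℕ.^ (n ℕ.∸ i))))
      ≡⟨ ∑-swap (gaps a b) (upTo (suc n)) (λ k i → w i ℚ.* fromℕ (k ℕ.^ (n ℕ.∸ i))) ⟩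
    (∑[ i ∈ upTo (suc n) ] (∑[ k ∈ gaps a b ] w i ℚ.* fromℕ (k ℕ.^ (n ℕ.∸ i))))
      ≡⟨ ∑-cong (upTo (suc n)) (λ i → trans
           (sym (*-∑ (w i) (gaps a b) (λ k → fromℕ (k ℕ.^ (n ℕ.∸ i)))))
           (cong (w i ℚ.*_) (sym (fromℕ-∑ (gaps a b) (ℕ._^ (n ℕ.∸ i)))))) ⟩
    (∑[ i ∈ upTo (suc n) ] w i ℚ.* fromℕ (sylvesterSum a b (n ℕ.∸ i))) ∎
    where
    w : ℕ → ℚ
    w i = fromℕ ((n C i) ℕ.* N ℕ.^ i) ℚ.* bernoulli i

  module _ (coprime : Coprime a b) (n : ℕ) where
    private
      A B αa αb gapPart periodPart : ℚ
      A = fromℕ a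
      B = fromℕ b
      -- This is aⁿ⁻¹, written with a reciprocal so that n = 0 is covered.
      αa = A ^ n ℚ.* recip a
      αb = B ^ n ℚ.* recip b
      gapPart    = ∑[ k ∈ gaps a b ] bernoulliFun n (+ k / N)
      periodPart = ∑[ k ∈ upTo N ] (+ k / N) ℚ.* bernoulliFun n (+ k / N)

      recip-cancel : ∀ d .{{_ : NonZero d}} x → fromℕ d ℚ.* (x ℚ.* recip d) ≡ x
      recip-cancel d x = trans (solve 3 (λ d x r → d :* (x :* r) := x :* (d :* r)) refl (fromℕ d) x (recip d))
        (trans (cong (x ℚ.*_) (fromℕ-recip d)) (ℚ.*-identityʳ x))

      reciprocity-bernoulliFun :
        αb ℚ.* apostolDedekind n a b ℚ.+ αa ℚ.* apostolDedekind n b a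
        ≡ αa ℚ.* αb ℚ.* gapPart ℚ.+ αa ℚ.* αb ℚ.* periodPart
      reciprocity-bernoulliFun = begin
        αb ℚ.* apostolDedekind n a b ℚ.+ αa ℚ.* apostolDedekind n b a
          ≡⟨ cong₂ (λ x y → αb ℚ.* x ℚ.+ αa ℚ.* y) (apostolDedekind-upTo n a b) (apostolDedekind-upTo n b a) ⟩
        αb ℚ.* (∑[ i ∈ upTo b ] (+ i / b) ℚ.* bernoulliFun n (+ (i ℕ.* a) / b))
          ℚ.+ αa ℚ.* (∑[ j ∈ upTo a ] (+ j / a) ℚ.* bernoulliFun n (+ (j ℕ.* b) / a))
          ≡⟨ Reciprocity.reciprocity-periodic ℚ-ℚAlgebra a b coprime αa αb ℚ.0ℚ ℚ.0ℚ (bernoulliFun n)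
               (λ i _ → trans (bernoulliFun-multiplication n a b i) (sym (ℚ.+-identityʳ _)))
               (λ j _ → trans (bernoulliFun-multiplication n b a j) (trans
                  -- With a and b exchanged, the multiplication formula yields the summands of the
                  -- argument in the opposite order.
                  (cong (αb ℚ.*_) (∑-cong (upTo b) (λ i → cong (bernoulliFun n) (ℚ.+-comm (+ j / a) (+ i / b)))))
                  (sym (ℚ.+-identityʳ _))))
               (λ y → trans (cong (bernoulliFun n) (ℚ.+-comm y 1ℚ)) (bernoulliFun-1+ n y)) ⟩
        αa ℚ.* αb ℚ.* gapPart ℚ.+ αa ℚ.* αb ℚ.* periodPart
          ℚ.+ αb ℚ.* ℚ.0ℚ ℚ.* (+ (b ℕ.∸ 1) / 2) ℚ.+ αa ℚ.* ℚ.0ℚ ℚ.* (+ (a ℕ.∸ 1) / 2)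
          ≡⟨ solve 6 (λ x y p q h k → x :* y :* p :+ x :* y :* q :+ y :* con ℚ.0ℚ :* h :+ x :* con ℚ.0ℚ :* k
                                      := x :* y :* p :+ x :* y :* q) refl
               αa αb gapPart periodPart (+ (b ℕ.∸ 1) / 2) (+ (a ℕ.∸ 1) / 2) ⟩
        αa ℚ.* αb ℚ.* gapPart ℚ.+ αa ℚ.* αb ℚ.* periodPart ∎

    -- Multiplication by ab raises the factors aⁿ⁻¹ and bⁿ⁻¹ to the stated coefficients on the left,
    -- and their product to (ab)ⁿ on the right.
    apostolDedekind-reciprocity :
      fromℕ (a ℕ.* b ℕ.^ n) ℚ.* apostolDedekind n a b ℚ.+ fromℕ (b ℕ.* a ℕ.^ n) ℚ.* apostolDedekind n b a
      ≡ sylvesterPart n ℚ.+ bernoulliPart n ℚ.+ (+ n / suc n) ℚ.* bernoulli (suc n) ℚ.+ fromℕ N ℚ.* bernoulli n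
    apostolDedekind-reciprocity = begin
      fromℕ (a ℕ.* b ℕ.^ n) ℚ.* s ℚ.+ fromℕ (b ℕ.* a ℕ.^ n) ℚ.* s′
        ≡⟨ cong₂ (λ x y → x ℚ.* s ℚ.+ y ℚ.* s′) (leading a b) (leading b a) ⟩
      A ℚ.* (B ℚ.* αb) ℚ.* s ℚ.+ B ℚ.* (A ℚ.* αa) ℚ.* s′
        ≡⟨ solve 6 (λ a b x y s t → a :* (b :* y) :* s :+ b :* (a :* x) :* t := a :* b :* (y :* s :+ x :* t)) refl
             A B αa αb s s′ ⟩
      A ℚ.* B ℚ.* (αb ℚ.* s ℚ.+ αa ℚ.* s′)
        ≡⟨ cong (A ℚ.* B ℚ.*_) reciprocity-bernoulliFun ⟩
      A ℚ.* B ℚ.* (αa ℚ.* αb ℚ.* gapPart ℚ.+ αa ℚ.* αb ℚ.* periodPart)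
        ≡⟨ solve 6 (λ a b x y p q → a :* b :* (x :* y :* p :+ x :* y :* q)
                                    := (a :* x) :* (b :* y) :* p :+ (a :* x) :* (b :* y) :* q) refl
             A B αa αb gapPart periodPart ⟩
      A ℚ.* αa ℚ.* (B ℚ.* αb) ℚ.* gapPart ℚ.+ A ℚ.* αa ℚ.* (B ℚ.* αb) ℚ.* periodPart
        ≡⟨ cong (λ x → x ℚ.* gapPart ℚ.+ x ℚ.* periodPart) Nⁿ ⟩
      fromℕ N ^ n ℚ.* gapPart ℚ.+ fromℕ N ^ n ℚ.* periodPart
        ≡⟨ cong₂ ℚ._+_ (gap-sum n) (trans
             (cong (fromℕ N ^ n ℚ.*_) (∑-cong-< N (λ k k<N → cong ((+ k / N) ℚ.*_) (bernoulliFun-proper n k N k<N))))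
             (bernoulliPoly-weighted-sum N n)) ⟩
      sylvesterPart n ℚ.+ (bernoulliPart n ℚ.+ t ℚ.+ fromℕ N ℚ.* bernoulli n)
        ≡⟨ solve 4 (λ x y z w → x :+ (y :+ z :+ w) := x :+ y :+ z :+ w) refl
             (sylvesterPart n) (bernoulliPart n) t (fromℕ N ℚ.* bernoulli n) ⟩
      sylvesterPart n ℚ.+ bernoulliPart n ℚ.+ t ℚ.+ fromℕ N ℚ.* bernoulli n ∎
      where
      s  = apostolDedekind n a b
      s′ = apostolDedekind n b a
      t  = (+ n / suc n) ℚ.* bernoulli (suc n)

      leading : ∀ a b .{{_ : NonZero b}} →
        fromℕ (a ℕ.* b ℕ.^ n) ≡ fromℕ a ℚ.* (fromℕ b ℚ.* (fromℕ b ^ n ℚ.* recip b))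
      leading a b = trans (fromℕ-* a (b ℕ.^ n))
        (cong (fromℕ a ℚ.*_) (trans (fromℕ-^ b n) (sym (recip-cancel b (fromℕ b ^ n)))))

      Nⁿ : A ℚ.* αa ℚ.* (B ℚ.* αb) ≡ fromℕ N ^ n
      Nⁿ = begin
        A ℚ.* αa ℚ.* (B ℚ.* αb)      ≡⟨ cong₂ ℚ._*_ (recip-cancel a (A ^ n)) (recip-cancel b (B ^ n)) ⟩
        A ^ n ℚ.* B ^ n              ≡⟨ ^-distrib-* A B n ⟨
        (A ℚ.* B) ^ n                ≡⟨ cong (_^ n) (fromℕ-* a b) ⟨
        fromℕ N ^ n                  ∎

-- Since n = 1 + 2 (n/2), a zero quotient would give n = 1, where B₁ = -1/2; a quotient q + 1 gives
-- n = 3 + 2q.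
bernoulli-odd-vanishes : ∀ n → n % 2 ≡ 1 → 1 < n → bernoulli n ≡ ℚ.0ℚ
bernoulli-odd-vanishes n odd 1<n with n ℕ./ 2 | trans (m≡m%n+[m/n]*n n 2) (cong (ℕ._+ n ℕ./ 2 ℕ.* 2) odd)
... | zero  | refl = contradiction 1<n λ { (s≤s ()) }
... | suc q | refl = bernoulli-odd q

mainTheorem3 :
  ∀ (c ℓ : Level) (a b : ℕ) .{{_ : NonZero a}} .{{_ : NonZero b}} → Coprime a b →
  (∀ (K : ℚAlgebra c ℓ) →
   let open ℚAlgebra K
       instance
         ab≢0 : NonZero (a ℕ.* b)
         ab≢0 = m*n≢0 a b
   in
   ∀ (αa αb βa βb : Carrier) (f : ℚ → Carrier) →
   (∀ i → i < b →
      f (+ (i ℕ.* a) / b) ≈ αa * (∑[ j ∈ upTo a ] f ((+ i / b) ℚ.+ (+ j / a))) + βa) →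
   (∀ j → j < a →
      f (+ (j ℕ.* b) / a) ≈ αb * (∑[ i ∈ upTo b ] f ((+ i / b) ℚ.+ (+ j / a))) + βb) →
   (αb * (∑[ i ∈ upTo b ] ι (+ i / b) * f (+ (i ℕ.* a) / b))
      + αa * (∑[ j ∈ upTo a ] ι (+ j / a) * f (+ (j ℕ.* b) / a))
    ≈ αa * αb * (∑[ k ∈ gaps a b ]
          (ι ((+ k / (a ℕ.* b)) ℚ.+ 1ℚ) * f ((+ k / (a ℕ.* b)) ℚ.+ 1ℚ)
           - ι (+ k / (a ℕ.* b)) * f (+ k / (a ℕ.* b))))
      + αa * αb * (∑[ k ∈ upTo (a ℕ.* b) ] ι (+ k / (a ℕ.* b)) * f (+ k / (a ℕ.* b)))
      + αb * βa * ι (+ (b ℕ.∸ 1) / 2)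
      + αa * βb * ι (+ (a ℕ.∸ 1) / 2))
   ×
   ((∀ x → f (x ℚ.+ 1ℚ) ≈ f x) →
    αb * (∑[ i ∈ upTo b ] ι (+ i / b) * f (+ (i ℕ.* a) / b))
      + αa * (∑[ j ∈ upTo a ] ι (+ j / a) * f (+ (j ℕ.* b) / a))
    ≈ αa * αb * (∑[ k ∈ gaps a b ] f (+ k / (a ℕ.* b)))
      + αa * αb * (∑[ k ∈ upTo (a ℕ.* b) ] ι (+ k / (a ℕ.* b)) * f (+ k / (a ℕ.* b)))
      + αb * βa * ι (+ (b ℕ.∸ 1) / 2)
      + αa * βb * ι (+ (a ℕ.∸ 1) / 2)))
  ×
  (∀ (n : ℕ) →
   let open FiniteSum ℚ.+-0-rawMonoid
       lhs = (+ (a ℕ.* b ℕ.^ n) / 1) ℚ.* apostolDedekind n a b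
               ℚ.+ (+ (b ℕ.* a ℕ.^ n) / 1) ℚ.* apostolDedekind n b a
       rhs = (∑[ i ∈ upTo (suc n) ]
                (+ ((n C i) ℕ.* (a ℕ.* b) ℕ.^ i) / 1) ℚ.* bernoulli i
                  ℚ.* (+ sylvesterSum a b (n ℕ.∸ i) / 1))
               ℚ.+ (∑[ i ∈ upTo (suc (suc n)) ]
                (_/_ (+ (n ! ℕ.* (a ℕ.* b) ℕ.^ (suc n ℕ.∸ i))) (i ! ℕ.* (suc n ℕ.∸ i) !)
                  {{i !* (suc n ℕ.∸ i) !≢0}})
                  ℚ.* bernoulli i ℚ.* bernoulli (suc n ℕ.∸ i))
               ℚ.+ (+ n / suc n) ℚ.* bernoulli (suc n)
   in (n % 2 ≡ 1 → 1 < n → lhs ≡ rhs)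
      × (lhs ≡ rhs ℚ.+ (+ (a ℕ.* b) / 1) ℚ.* bernoulli n))
mainTheorem3 c ℓ a b coprime =
  (λ K αa αb βa βb f f-a f-b → let open Reciprocity K a b in
     reciprocity coprime αa αb βa βb f f-a f-b , reciprocity-periodic coprime αa αb βa βb f f-a f-b) ,
  (λ n → (λ odd 1<n → trans (apostolDedekind-reciprocity a b coprime n) (drop-term n (bernoulli-odd-vanishes n odd 1<n))) ,
         apostolDedekind-reciprocity a b coprime n)
  where
  drop-term : ∀ n {x} → bernoulli n ≡ ℚ.0ℚ → x ℚ.+ fromℕ (a ℕ.* b) ℚ.* bernoulli n ≡ x
  drop-term n {x} Bₙ≡0 = trans (cong (λ y → x ℚ.+ fromℕ (a ℕ.* b) ℚ.* y) Bₙ≡0)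
    (trans (cong (x ℚ.+_) (ℚ.*-zeroʳ (fromℕ (a ℕ.* b)))) (ℚ.+-identityʳ x))
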